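{- Let $G=(V,E,s)$ be a connected undirected graph with source $s$, with $n$ vertices and $m$ edges. A LexDFS ordering of $G$ can be computed in time $O(n+m\log(m))$.
   Context: A (undirected) graph with a source is a triple $(V,E,s)$ where $V$ is a finite set (of vertices), $E$ is a set of two-element subsets of $V$ (edges), and $s\in V$. The neighborhood of $v$ is $N(v)=\{w\mid\{v,w\}\in E\}$. The graph is connected if every pair of distinct vertices is joined by a path. Lexicographic order on words: $\mathbf a=a_1\dots a_p$ is smaller than $\mathbf b=b_1\dots b_q$ if there is $0\le i\le\min(p,q)$ such that $a_j=b_j$ for all $1\le j\le i$ and either $i=p<q$ or ($i<\min(p,q)$ and $a_{i+1}<b_{i+1}$). The symbol $\infty$ is larger than every integer. LexDFS is the following (nondeterministic) search procedure on $G=(V,E,s)$ with $n=|V|$. Every vertex carries a label, which is a word; initially the label of every vertex is the empty word, except the label of $s$, which is the one-letter word $\infty$. All vertices are initially unnumbered. For $i=1,\dots,n$: choose an unnumbered vertex $v$ whose label is lexicographically maximal among the labels of unnumbered vertices (ties broken arbitrarily); set $\sigma[i]:=v$ (so $v$ becomes numbered); then for every unnumbered $w\in N(v)$, prepend $i$ to the label of $w$ (i.e. add it at the front). The output is $\sigma$. A LexDFS ordering of $G$ is any possible output $\sigma$ of this procedure on $G$. Computation model: vertices are $v_1,\dots,v_n$, and the graph is given as an array of size $n$ whose $i$-th entry is the (doubly linked) list of neighbors of $v_i$. Integers of absolute value at most $\max(|V|,2|E|)$ can be assigned, incremented and compared in constant time. Arrays are created in time linear in their size, with constant-time read and write of entries.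 Doubly linked lists support constant-time access to the first and last node, insertion at either end, access to the predecessor, successor and value of a node, insertion before or after a given node, and removal of a given node; a list of $k$ nodes with constant-time comparisons can be sorted in time $O(k\log k)$. By convention $m\log m=0$ when $m=0$. -}

module Defs where

open import Data.Bool.Base using (Bool; true; false; if_then_else_; not; _∧_; T)
open import Data.Fin.Base using (Fin; toℕ)
import Data.Fin.Properties as Fin
open import Data.Integer.Base as ℤ using (ℤ; +_)
import Data.Integer.Properties as ℤ
open import Data.List.Base as List
  using (List; []; _∷_; _++_; _∷ʳ_; length; map; tabulate; replicate;
         zip; upTo; allFin; filterᵇ; cartesianProduct)
open import Data.List.Membership.Propositional using (_∈_; _∉_)
import Data.List.Membership.DecPropositional as DecMembership
open import Data.List.Relation.Binary.Lex.Strict using (Lex-<)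
open import Data.List.Relation.Unary.Unique.Propositional using (Unique)
import Data.List.Sort as Sort
open import Data.Maybe.Base using (Maybe; just; nothing; maybe′; _>>=_)
open import Data.Nat.Base using (ℕ; zero; suc; _+_; _*_; _⊔_; _<_; _≤ᵇ_; _<ᵇ_; _≡ᵇ_)
open import Data.Nat.Logarithm using (⌈log₂_⌉)
open import Data.Product.Base using (_×_; _,_; proj₁; proj₂; ∃; ∃-syntax)
open import Function.Bundles using (_⇔_)
import Relation.Binary.Construct.On as On
open import Relation.Binary.Construct.Add.Supremum.Strict {A = ℕ} _<_ using (_<⁺_)
open import Relation.Binary.Construct.Closure.ReflexiveTransitive using (Star)
open import Relation.Binary.PropositionalEquality using (_≡_; _≢_)
open import Relation.Nullary using (¬_; does)
open import Relation.Nullary.Construct.Add.Supremum using (_⁺; ⊤⁺; [_])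

------------------------------------------------------------------------
-- Graphs with a source

-- The vertices v₁, …, vₙ are the elements of Fin n; an edge {v , w} is a pair
-- with edge? v w (equivalently edge? w v) true.

record Graph : Set where
  field
    n           : ℕ
    edge?       : Fin n → Fin n → Bool
    symmetric   : ∀ v w → edge? v w ≡ edge? w v
    irreflexive : ∀ v → edge? v v ≡ false
    source      : Fin n

  V : Set
  V = Fin n

  Edge : V → V → Set
  Edge v w = T (edge? v w)

  -- Each edge {v , w} is counted once, at v < w.
  m : ℕ
  m = length (filterᵇ (λ { (v , w) → (toℕ v <ᵇ toℕ w) ∧ edge? v w })
                      (cartesianProduct (allFin n) (allFin n)))

  Connected : Set
  Connected = ∀ v w → v ≢ w → Star Edge v w

------------------------------------------------------------------------
-- LexDFS

-- Words over ℕ ∪ {∞}, where ⊤⁺ is the letter ∞.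

Word : Set
Word = List (ℕ ⁺)

infix 4 _<ˡᵉˣ_

_<ˡᵉˣ_ : Word → Word → Set
_<ˡᵉˣ_ = Lex-< _≡_ _<⁺_

module LexDFS (G : Graph) where
  open Graph G
  open DecMembership (Fin._≟_ {n}) using (_∈?_)

  initialLabel : V → Word
  initialLabel v = if does (v Fin.≟ source) then ⊤⁺ ∷ [] else []

  -- Here σ lists the numbered vertices, v included.
  prepend : ℕ → V → List V → (V → Word) → (V → Word)
  prepend i v σ label w =
    if edge? v w ∧ not (does (w ∈? σ)) then [ i ] ∷ label w else label w

  -- Search i label σ: some execution has, after i iterations, these labels and
  -- the numbered vertices σ = σ[1], …, σ[i].
  data Search : ℕ → (V → Word) → List V → Set where
    start : Search 0 initialLabel []
    step  : ∀ {i label σ} (v : V) →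
            Search i label σ →
            v ∉ σ →
            (∀ w → w ∉ σ → ¬ (label v <ˡᵉˣ label w)) →
            Search (suc i) (prepend (suc i) v (σ ∷ʳ v) label) (σ ∷ʳ v)

  IsLexDFSOrdering : List V → Set
  IsLexDFSOrdering σ = ∃[ label ] Search n label σ

open LexDFS public using (IsLexDFSOrdering)

------------------------------------------------------------------------
-- The machine: a first-order imperative language over integers, arrays and
-- doubly linked lists. A program is a finite text, so it cannot depend on the
-- input and every computation it performs is charged for.

data Val : Set where
  nil  : Val
  int  : ℤ → Val
  ref  : ℕ → Val        -- an array or a list, by its address
  node : ℕ → ℕ → Val    -- node ℓ k: the node with identifier k of the list at ℓ

Node : Set
Node = ℕ × Val          -- identifier and value

data Obj : Set where
  array : List Val → Obj
  dll   : ℕ → List Node → Obj   -- the next fresh identifier; the nodes in order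

Heap : Set
Heap = List Obj          -- the object with address a is the a-th entry

Reg : Set
Reg = ℕ

record State : Set where
  constructor ⟨_,_⟩
  field
    regs : Reg → Val
    heap : Heap
open State public

data Instr : Set where
  const                   : (x : Reg) → ℤ → Instr
  setNil                  : (x : Reg) → Instr
  copy                    : (x y : Reg) → Instr
  incr                    : (x : Reg) → Instr
  newArray                : (x size init : Reg) → Instr
  read                    : (x a i : Reg) → Instr
  write                   : (a i y : Reg) → Instr
  newList                 : (x : Reg) → Instr
  first last             : (x l : Reg) → Instr
  pred succ value         : (x p : Reg) → Instr
  pushFront pushBack      : (l y : Reg) → Instr
  insertBefore insertAfter : (p y : Reg) → Instr
  remove                  : (p : Reg) → Instr
  -- Sorts the list l by nondecreasing a[value of the node].
  sortBy                  : (l a : Reg) → Instr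

data Cond : Set where
  less equal : (x y : Reg) → Cond
  isNil      : (x : Reg) → Cond
  neg        : Cond → Cond

infixr 5 _⨟_

data Cmd : Set where
  instr      : Instr → Cmd
  skip       : Cmd
  _⨟_        : Cmd → Cmd → Cmd
  ifᶜ        : Cond → Cmd → Cmd → Cmd
  while      : Cond → Cmd → Cmd

------------------------------------------------------------------------
-- Its semantics; nothing stands for an illegal operation, on which execution
-- is stuck.

infixl 9 _‼_

_‼_ : {A : Set} → List A → ℕ → Maybe A
[]       ‼ _     = nothing
(x ∷ _)  ‼ zero  = just x
(_ ∷ xs) ‼ suc i = xs ‼ i

set : {A : Set} → ℕ → A → List A → Maybe (List A)
set _       _ []       = nothing
set zero    y (_ ∷ xs) = just (y ∷ xs)
set (suc i) y (x ∷ xs) = set i y xs >>= λ xs′ → just (x ∷ xs′)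

_[_↦_] : (Reg → Val) → Reg → Val → (Reg → Val)
(ρ [ x ↦ u ]) y = if y ≡ᵇ x then u else ρ y

asInt : Val → Maybe ℤ
asInt (int z) = just z
asInt _       = nothing

asℕ : Val → Maybe ℕ
asℕ (int (+ k)) = just k
asℕ _           = nothing

asNode : Val → Maybe (ℕ × ℕ)
asNode (node ℓ k) = just (ℓ , k)
asNode _          = nothing

getArray : Heap → Val → Maybe (ℕ × List Val)
getArray h (ref a) = h ‼ a >>= λ
  { (array us) → just (a , us)
  ; (dll _ _)  → nothing }
getArray _ _       = nothing

getListAt : Heap → ℕ → Maybe (ℕ × List Node)
getListAt h ℓ = h ‼ ℓ >>= λ
  { (array _)  → nothing
  ; (dll f ns) → just (f , ns) }

getList : Heap → Val → Maybe (ℕ × ℕ × List Node)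
getList h (ref ℓ) = getListAt h ℓ >>= λ (f , ns) → just (ℓ , f , ns)
getList _ _       = nothing

-- The nodes before, the value of, and the nodes after the node identified by k.
focus : ℕ → List Node → Maybe (List Node × Val × List Node)
focus k []             = nothing
focus k ((j , u) ∷ ns) =
  if k ≡ᵇ j then just ([] , u , ns)
  else (focus k ns >>= λ (bs , u′ , as) → just ((j , u) ∷ bs , u′ , as))

record Focused : Set where
  constructor focused
  field
    addr fresh ident : ℕ
    before           : List Node
    val              : Val
    after            : List Node

getNode : Heap → Val → Maybe Focused
getNode h p =
  asNode p >>= λ (ℓ , k) →
  getListAt h ℓ >>= λ (f , ns) →
  focus k ns >>= λ (bs , u , as) →
  just (focused ℓ f k bs u as)

toNode : ℕ → Maybe Node → Val
toNode ℓ = maybe′ (λ (k , _) → node ℓ k) nil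

withKeys : List Val → List Node → Maybe (List (ℤ × Node))
withKeys us []             = just []
withKeys us ((k , u) ∷ ns) =
  asℕ u >>= λ i →
  us ‼ i >>= λ e →
  asInt e >>= λ z →
  withKeys us ns >>= λ zns →
  just ((z , k , u) ∷ zns)

-- The library's sort is abstract: only that it returns a sorted permutation is
-- available, so no stability or other tie-breaking is promised.
sortKeyed : List (ℤ × Node) → List (ℤ × Node)
sortKeyed = Sort.sort (On.decTotalOrder ℤ.≤-decTotalOrder proj₁)

-- W bounds the absolute value of the integers the machine can handle.
module Machine (W : ℕ) where

  bounded : ℤ → Maybe ℤ
  bounded z = if ℤ.∣ z ∣ ≤ᵇ W then just z else nothing

  -- The resulting state and the time taken.
  exec : Instr → State → Maybe (State × ℕ)
  exec (const x z) ⟨ ρ , h ⟩ =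
    bounded z >>= λ z′ → just (⟨ ρ [ x ↦ int z′ ] , h ⟩ , 1)
  exec (setNil x) ⟨ ρ , h ⟩ = just (⟨ ρ [ x ↦ nil ] , h ⟩ , 1)
  exec (copy x y) ⟨ ρ , h ⟩ = just (⟨ ρ [ x ↦ ρ y ] , h ⟩ , 1)
  exec (incr x) ⟨ ρ , h ⟩ =
    asInt (ρ x) >>= λ z →
    bounded (ℤ.suc z) >>= λ z′ →
    just (⟨ ρ [ x ↦ int z′ ] , h ⟩ , 1)
  exec (newArray x size init) ⟨ ρ , h ⟩ =
    asℕ (ρ size) >>= λ k →
    just (⟨ ρ [ x ↦ ref (length h) ] , h ∷ʳ array (replicate k (ρ init)) ⟩ , 1 + k)
  exec (read x a i) ⟨ ρ , h ⟩ =
    getArray h (ρ a) >>= λ (_ , us) →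
    asℕ (ρ i) >>= λ j →
    us ‼ j >>= λ u →
    just (⟨ ρ [ x ↦ u ] , h ⟩ , 1)
  exec (write a i y) ⟨ ρ , h ⟩ =
    getArray h (ρ a) >>= λ (b , us) →
    asℕ (ρ i) >>= λ j →
    set j (ρ y) us >>= λ us′ →
    set b (array us′) h >>= λ h′ →
    just (⟨ ρ , h′ ⟩ , 1)
  exec (newList x) ⟨ ρ , h ⟩ =
    just (⟨ ρ [ x ↦ ref (length h) ] , h ∷ʳ dll 0 [] ⟩ , 1)
  exec (first x l) ⟨ ρ , h ⟩ =
    getList h (ρ l) >>= λ (ℓ , _ , ns) →
    just (⟨ ρ [ x ↦ toNode ℓ (List.head ns) ] , h ⟩ , 1)
  exec (last x l) ⟨ ρ , h ⟩ =
    getList h (ρ l) >>= λ (ℓ , _ , ns) →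
    just (⟨ ρ [ x ↦ toNode ℓ (List.last ns) ] , h ⟩ , 1)
  exec (pred x p) ⟨ ρ , h ⟩ =
    getNode h (ρ p) >>= λ (focused ℓ _ _ bs _ _) →
    just (⟨ ρ [ x ↦ toNode ℓ (List.last bs) ] , h ⟩ , 1)
  exec (succ x p) ⟨ ρ , h ⟩ =
    getNode h (ρ p) >>= λ (focused ℓ _ _ _ _ as) →
    just (⟨ ρ [ x ↦ toNode ℓ (List.head as) ] , h ⟩ , 1)
  exec (value x p) ⟨ ρ , h ⟩ =
    getNode h (ρ p) >>= λ (focused _ _ _ _ u _) →
    just (⟨ ρ [ x ↦ u ] , h ⟩ , 1)
  exec (pushFront l y) ⟨ ρ , h ⟩ =
    getList h (ρ l) >>= λ (ℓ , f , ns) →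
    set ℓ (dll (suc f) ((f , ρ y) ∷ ns)) h >>= λ h′ →
    just (⟨ ρ , h′ ⟩ , 1)
  exec (pushBack l y) ⟨ ρ , h ⟩ =
    getList h (ρ l) >>= λ (ℓ , f , ns) →
    set ℓ (dll (suc f) (ns ∷ʳ (f , ρ y))) h >>= λ h′ →
    just (⟨ ρ , h′ ⟩ , 1)
  exec (insertBefore p y) ⟨ ρ , h ⟩ =
    getNode h (ρ p) >>= λ (focused ℓ f k bs u as) →
    set ℓ (dll (suc f) (bs ++ (f , ρ y) ∷ (k , u) ∷ as)) h >>= λ h′ →
    just (⟨ ρ , h′ ⟩ , 1)
  exec (insertAfter p y) ⟨ ρ , h ⟩ =
    getNode h (ρ p) >>= λ (focused ℓ f k bs u as) →
    set ℓ (dll (suc f) (bs ++ (k , u) ∷ (f , ρ y) ∷ as)) h >>= λ h′ →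
    just (⟨ ρ , h′ ⟩ , 1)
  exec (remove p) ⟨ ρ , h ⟩ =
    getNode h (ρ p) >>= λ (focused ℓ f _ bs _ as) →
    set ℓ (dll f (bs ++ as)) h >>= λ h′ →
    just (⟨ ρ , h′ ⟩ , 1)
  exec (sortBy l a) ⟨ ρ , h ⟩ =
    getList h (ρ l) >>= λ (ℓ , f , ns) →
    getArray h (ρ a) >>= λ (_ , us) →
    withKeys us ns >>= λ zns →
    set ℓ (dll f (map proj₂ (sortKeyed zns))) h >>= λ h′ →
    just (⟨ ρ , h′ ⟩ , 1 + length ns * ⌈log₂ length ns ⌉)

  test : Cond → State → Maybe Bool
  test (less x y) ⟨ ρ , _ ⟩ =
    asInt (ρ x) >>= λ z → asInt (ρ y) >>= λ z′ → just (does (z ℤ.<? z′))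
  test (equal x y) ⟨ ρ , _ ⟩ =
    asInt (ρ x) >>= λ z → asInt (ρ y) >>= λ z′ → just (does (z ℤ.≟ z′))
  test (isNil x) ⟨ ρ , _ ⟩ with ρ x
  ... | nil = just true
  ... | _   = just false
  test (neg b) s = test b s >>= λ r → just (not r)

  -- c , s ⇓ s′ ∣ t: command c, started in s, terminates in s′ after time t.
  -- At most one rule applies to a given c and s, so executions are deterministic.
  infix 4 _,_⇓_∣_

  data _,_⇓_∣_ : Cmd → State → State → ℕ → Set where
    ⇓-instr : ∀ {i s s′ t} → exec i s ≡ just (s′ , t) → instr i , s ⇓ s′ ∣ t
    ⇓-skip  : ∀ {s} → skip , s ⇓ s ∣ 1
    ⇓-seq   : ∀ {c d s s′ s″ t u} →
              c , s ⇓ s′ ∣ t → d , s′ ⇓ s″ ∣ u → c ⨟ d , s ⇓ s″ ∣ t + u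
    ⇓-then  : ∀ {b c d s s′ t} → test b s ≡ just true →
              c , s ⇓ s′ ∣ t → ifᶜ b c d , s ⇓ s′ ∣ 1 + t
    ⇓-else  : ∀ {b c d s s′ t} → test b s ≡ just false →
              d , s ⇓ s′ ∣ t → ifᶜ b c d , s ⇓ s′ ∣ 1 + t
    ⇓-stop  : ∀ {b c s} → test b s ≡ just false → while b c , s ⇓ s ∣ 1
    ⇓-loop  : ∀ {b c s s′ s″ t u} → test b s ≡ just true →
              c , s ⇓ s′ ∣ t → while b c , s′ ⇓ s″ ∣ u →
              while b c , s ⇓ s″ ∣ 1 + t + u

open Machine public using () renaming (_,_⇓_∣_ to _⊢_,_⇓_∣_)

------------------------------------------------------------------------
-- Input and output conventions

-- The neighbours of each vertex, in an arbitrary order.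
record AdjacencyLists (G : Graph) : Set where
  open Graph G
  field
    neighbours : V → List V
    unique     : ∀ v → Unique (neighbours v)
    complete   : ∀ v w → w ∈ neighbours v ⇔ Edge v w

-- Vertices are represented by the integers 0, …, n - 1.
vertex : ∀ {n} → Fin n → Val
vertex v = int (+ toℕ v)

adjacencyList : ∀ {n} → List (Fin n) → Obj
adjacencyList ws = dll (length ws) (zip (upTo (length ws)) (map vertex ws))

-- Register 0 holds the array of neighbour lists, register 1 the number of
-- vertices and register 2 the source.
input : {G : Graph} → AdjacencyLists G → State
input {G} A = ⟨ ρ , array (tabulate λ (v : V) → ref (suc (toℕ v)))
                    ∷ tabulate (λ v → adjacencyList (neighbours v)) ⟩
  where
  open Graph G
  open AdjacencyLists A
  ρ : Reg → Val
  ρ 0 = ref 0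
  ρ 1 = int (+ n)
  ρ 2 = vertex source
  ρ _ = nil

-- The output is the array that register 0 refers to.
Outputs : ∀ {n} → State → List (Fin n) → Set
Outputs s σ = ∃[ a ] regs s 0 ≡ ref a × heap s ‼ a ≡ just (array (map vertex σ))

wordBound : Graph → ℕ
wordBound G = n ⊔ 2 * m
  where open Graph G

{-# OPTIONS --safe #-}

-- The vertices are kept on a stack, on which a vertex may occur several times, and each
-- vertex has a key: the time of its last push. The search pops u and, unless u is already
-- numbered, numbers it and pushes its neighbours in increasing order of their keys. Numbering
-- u prepends to the labels of its unnumbered neighbours a letter exceeding all earlier ones:
-- they overtake the other vertices, while within the two groups nothing changes. The keys
-- change in the same way, so a larger key never goes with a smaller label, and the topmost
-- unnumbered vertex of the stack has a maximal label. Equal labels need not have equal keys,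
-- since ties may be broken arbitrarily. Sorting the neighbours of all vertices costs
-- Σ d log d ≤ 2m log 2m, and everything else is linear in n and in the number n + 1 + 2m of
-- pushes; the keys never exceed 2m.

module Submission where

open import Defs
open import Data.Bool.Base using (Bool; true; false; if_then_else_; not; _∧_; T)
open import Data.Bool.Properties using (T?; T-∧; T-≡)
open import Data.Empty using (⊥-elim)
open import Data.Fin.Base using (Fin; zero; suc; toℕ; fromℕ<)
import Data.Fin.Properties as Fin
open import Data.Integer.Base as ℤ using (ℤ; +_; -[1+_]; +≤+; -≤+)
import Data.Integer.Properties as ℤ
open import Data.List.Base as List
  using (List; []; _∷_; _++_; _∷ʳ_; _ʳ++_; length; map; tabulate; replicate; concatMap;
         zip; upTo; allFin; filterᵇ; cartesianProduct)
import Data.List.Membership.DecPropositional as DecMembership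
open import Data.List.Membership.Propositional using (_∈_; _∉_)
open import Data.List.Membership.Propositional.Properties
  using (∈-∃++; ∈-allFin; ∈-cartesianProduct⁺; ∈-filter⁺; ∈-map⁺; ∈-map⁻;
         ∈-++⁺ˡ; ∈-++⁺ʳ; ∈-++⁻; ∈-concatMap⁻)
open import Data.List.Properties as List using (length-++; length-map)
open import Data.List.Relation.Binary.Lex using (halt; this; next; base)
open import Data.List.Relation.Binary.Permutation.Propositional using (_↭_; ↭-sym; ↭⇒↭ₛ)
open import Data.List.Relation.Binary.Permutation.Propositional.Properties as ↭
  using (shift; ∷↭∷ʳ; ∈-resp-↭; ↭-length)
import Data.List.Relation.Binary.Permutation.Setoid.Properties as ↭ₛ
open import Data.List.Relation.Binary.Subset.Propositional using (_⊆_)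
open import Data.List.Relation.Unary.All as All using (All; []; _∷_)
import Data.List.Relation.Unary.All.Properties as All
open import Data.List.Relation.Unary.AllPairs using (AllPairs; []; _∷_)
import Data.List.Relation.Unary.AllPairs.Properties as AllPairs
open import Data.List.Relation.Unary.Any using (here; there; satisfied)
open import Data.List.Relation.Unary.Sorted.TotalOrder.Properties using (Sorted⇒AllPairs)
open import Data.List.Relation.Unary.Unique.Propositional using (Unique)
import Data.List.Relation.Unary.Unique.Propositional.Properties as Unique
import Data.List.Sort as Sort
open import Data.Maybe.Base using (just; nothing)
open import Data.Nat.Base as ℕ
  using (ℕ; zero; suc; _+_; _*_; _∸_; _≤_; _<_; _<ᵇ_; z≤n; s≤s; ⌊_/2⌋)
open import Data.Nat.Induction using (<-rec)
open import Data.Nat.ListAction using (sum)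
open import Data.Nat.ListAction.Properties using (sum-↭)
open import Data.Nat.Logarithm
  using (⌊log₂_⌋; ⌈log₂_⌉; ⌊log₂⌋-mono-≤; ⌈log₂⌉-mono-≤;
         ⌈log₂⌈n/2⌉⌉≡⌈log₂n⌉∸1; ⌊log₂⌊n/2⌋⌋≡⌊log₂n⌋∸1; ⌈log₂2*n⌉≡1+⌈log₂n⌉)
import Data.Nat.Properties as ℕ
open import Data.Nat.Tactic.RingSolver using (solve-∀)
open import Data.Product.Base as Product using (_×_; _,_; proj₁; proj₂; ∃-syntax; swap)
open import Data.Product.Properties using (,-injectiveʳ)
open import Data.Sum.Base using (_⊎_; inj₁; inj₂; [_,_]′)
open import Data.Vec.Functional using (updateAt)
open import Data.Vec.Functional.Properties using (updateAt-updates; updateAt-minimal)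
open import Function.Base using (_∘_; id)
open import Function.Bundles using (Equivalence)
open import Relation.Binary.Construct.Add.Supremum.Strict using ([_])
import Relation.Binary.Construct.On as On
open import Relation.Binary.Definitions using (tri<; tri≈; tri>)
open import Relation.Binary.PropositionalEquality
  using (_≡_; _≢_; refl; sym; trans; cong; subst; subst₂; ≢-sym; setoid; module ≡-Reasoning)
open import Relation.Nullary using (¬_; does; yes; no)
open import Relation.Nullary.Construct.Add.Supremum using (⊤⁺; [_])
open import Relation.Nullary.Decidable using (dec-true; dec-false; decidable-stable)

-- Sums over duplicate-free lists and rounded binary logarithms.

private
  variable
    A B : Set

-- One occurrence of the head of `xs` is cut out of `ys`. As the head does not recur in `xs`, the
-- tail is still contained in what remains, and induction applies.
sum-mono-⊆ : (f : A → ℕ) {xs ys : List A} → Unique xs → xs ⊆ ys →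
             sum (map f xs) ≤ sum (map f ys)
sum-mono-⊆ f [] _ = z≤n
sum-mono-⊆ f {x ∷ xs} (x∉xs ∷ xs!) xs⊆ys with ∈-∃++ (xs⊆ys (here refl))
... | as , bs , refl = begin
  f x + sum (map f xs)           ≤⟨ ℕ.+-monoʳ-≤ (f x) (sum-mono-⊆ f xs! xs⊆as++bs) ⟩
  f x + sum (map f (as ++ bs))   ≡⟨ sum-↭ (↭.map⁺ f (shift x as bs)) ⟨
  sum (map f (as ++ x ∷ bs))     ∎
  where
  open ℕ.≤-Reasoning
  xs⊆as++bs : xs ⊆ as ++ bs
  xs⊆as++bs z∈xs with ∈-resp-↭ (shift x as bs) (xs⊆ys (there z∈xs))
  ... | here refl = ⊥-elim (All.lookup x∉xs z∈xs refl)
  ... | there z∈  = z∈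

sum-map-1 : (xs : List A) → sum (map (λ _ → 1) xs) ≡ length xs
sum-map-1 []       = refl
sum-map-1 (_ ∷ xs) = cong suc (sum-map-1 xs)

length-mono-⊆ : {xs ys : List A} → Unique xs → xs ⊆ ys → length xs ≤ length ys
length-mono-⊆ {xs = xs} {ys} xs! xs⊆ys = begin
  length xs                 ≡⟨ sum-map-1 xs ⟨
  sum (map (λ _ → 1) xs)    ≤⟨ sum-mono-⊆ (λ _ → 1) xs! xs⊆ys ⟩
  sum (map (λ _ → 1) ys)    ≡⟨ sum-map-1 ys ⟩
  length ys                 ∎
  where open ℕ.≤-Reasoning

length-concatMap : (f : A → List B) (xs : List A) →
                   length (concatMap f xs) ≡ sum (map (length ∘ f) xs)
length-concatMap f []       = refl
length-concatMap f (x ∷ xs) =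
  trans (length-++ (f x)) (cong (length (f x) ℕ.+_) (length-concatMap f xs))

-- Strong induction by halving: the upper half of n + 1 is one more than the lower half of n, so the
-- claim keeps its shape while both logarithms drop by one.
⌈log₂[1+n]⌉≤1+⌊log₂n⌋ : ∀ n → ⌈log₂ suc n ⌉ ≤ 1 + ⌊log₂ n ⌋
⌈log₂[1+n]⌉≤1+⌊log₂n⌋ = <-rec _ bound
  where
  open ℕ.≤-Reasoning
  bound : ∀ n → (∀ {k} → k < n → ⌈log₂ suc k ⌉ ≤ 1 + ⌊log₂ k ⌋) →
          ⌈log₂ suc n ⌉ ≤ 1 + ⌊log₂ n ⌋
  bound zero          _   = z≤n
  bound (suc zero)    _   = ℕ.≤-refl
  bound (suc (suc k)) rec = begin
    ⌈log₂ 3 + k ⌉                ≤⟨ ℕ.m≤n+m∸n _ 1 ⟩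
    1 + (⌈log₂ 3 + k ⌉ ∸ 1)      ≡⟨ cong suc (⌈log₂⌈n/2⌉⌉≡⌈log₂n⌉∸1 (3 + k)) ⟨
    1 + ⌈log₂ 2 + ⌊ k /2⌋ ⌉      ≤⟨ s≤s (rec (s≤s (s≤s (ℕ.⌊n/2⌋≤n k)))) ⟩
    2 + ⌊log₂ 1 + ⌊ k /2⌋ ⌋      ≡⟨ cong (2 ℕ.+_) (⌊log₂⌊n/2⌋⌋≡⌊log₂n⌋∸1 (2 + k)) ⟩
    2 + (⌊log₂ 2 + k ⌋ ∸ 1)      ≡⟨ cong suc (ℕ.m+[n∸m]≡n (⌊log₂⌋-mono-≤ {2} {2 + k} (s≤s (s≤s z≤n)))) ⟩
    1 + ⌊log₂ 2 + k ⌋            ∎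

-- One unit pays for the factor 2, the other for the rounding. This turns the logarithm charged for
-- sorting into the one of the final bound.
⌈log₂[2*n]⌉≤2+⌊log₂n⌋ : ∀ n → ⌈log₂ (2 * n) ⌉ ≤ 2 + ⌊log₂ n ⌋
⌈log₂[2*n]⌉≤2+⌊log₂n⌋ zero      = z≤n
⌈log₂[2*n]⌉≤2+⌊log₂n⌋ n@(suc _) = begin
  ⌈log₂ (2 * n) ⌉     ≡⟨ ⌈log₂2*n⌉≡1+⌈log₂n⌉ n ⟩
  1 + ⌈log₂ n ⌉       ≤⟨ s≤s (⌈log₂⌉-mono-≤ (ℕ.n≤1+n n)) ⟩
  1 + ⌈log₂ suc n ⌉   ≤⟨ s≤s (⌈log₂[1+n]⌉≤1+⌊log₂n⌋ n) ⟩
  2 + ⌊log₂ n ⌋       ∎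
  where open ℕ.≤-Reasoning

-- The degree sum, by counting arcs.

module Degrees {G : Graph} (A : AdjacencyLists G) where
  open Graph G
  open AdjacencyLists A

  degree : V → ℕ
  degree v = length (neighbours v)

  private
    isForward : V × V → Bool
    isForward (v , w) = (toℕ v <ᵇ toℕ w) ∧ edge? v w

    -- This is the list whose length defines `m`.
    forward : List (V × V)
    forward = filterᵇ isForward (cartesianProduct (allFin n) (allFin n))

    arcsFrom : V → List (V × V)
    arcsFrom v = map (v ,_) (neighbours v)

    arcs : List (V × V)
    arcs = concatMap arcsFrom (allFin n)

    ∈-arcsFrom⁻ : ∀ {v p} → p ∈ arcsFrom v → proj₁ p ≡ v × Edge v (proj₂ p)
    ∈-arcsFrom⁻ {v} p∈ with ∈-map⁻ (v ,_) p∈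
    ... | w , w∈ , refl = refl , Equivalence.to (complete v w) w∈

    arcs! : Unique arcs
    arcs! = Unique.concat⁺
      (All.map⁺ (All.tabulate⁺ λ v → Unique.map⁺ ,-injectiveʳ (unique v)))
      (AllPairs.map⁺ (AllPairs.tabulate⁺ λ v≢w (p∈v , p∈w) →
        v≢w (trans (sym (proj₁ (∈-arcsFrom⁻ p∈v))) (proj₁ (∈-arcsFrom⁻ p∈w)))))

    ∈-forward : ∀ {v w} → toℕ v < toℕ w → Edge v w → (v , w) ∈ forward
    ∈-forward v<w e =
      ∈-filter⁺ (T? ∘ isForward) (∈-cartesianProduct⁺ (∈-allFin _) (∈-allFin _))
                (Equivalence.from T-∧ (ℕ.<⇒<ᵇ v<w , e))

    arcs⊆forward : arcs ⊆ forward ++ map swap forward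
    arcs⊆forward {v , w} p∈ with satisfied (∈-concatMap⁻ arcsFrom {xs = allFin n} p∈)
    ... | _ , p∈′ with ∈-arcsFrom⁻ p∈′
    ... | refl , e with ℕ.<-cmp (toℕ v) (toℕ w)
    ... | tri< v<w _ _ = ∈-++⁺ˡ (∈-forward v<w e)
    ... | tri> _ _ w<v = ∈-++⁺ʳ forward (∈-map⁺ swap (∈-forward w<v (subst T (symmetric v w) e)))
    ... | tri≈ _ v≡w _ with refl ← Fin.toℕ-injective v≡w =
      ⊥-elim (subst T (irreflexive v) e)

  -- Handshake argument: the ordered pairs of adjacent vertices are grouped by first component on
  -- the left, and each of them is a forward pair or the reversal of one.
  sum-degree≤2m : sum (map degree (allFin n)) ≤ 2 * m
  sum-degree≤2m = begin
    sum (map degree (allFin n))               ≡⟨ cong sum (List.map-cong (λ v → length-map (v ,_) (neighbours v))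
                                                                       (allFin n)) ⟨
    sum (map (length ∘ arcsFrom) (allFin n))  ≡⟨ length-concatMap arcsFrom (allFin n) ⟨
    length arcs                               ≤⟨ length-mono-⊆ arcs! arcs⊆forward ⟩
    length (forward ++ map swap forward)      ≡⟨ length-++ forward ⟩
    length forward + length (map swap forward) ≡⟨ cong (length forward ℕ.+_) (length-map swap forward) ⟩
    length forward + length forward           ≡⟨ cong (length forward ℕ.+_) (ℕ.+-identityʳ _) ⟨
    2 * length forward                        ≡⟨⟩
    2 * m                                     ∎
    where open ℕ.≤-Reasoning

-- Keys and labels

∉-∷ʳ⁻ : {A : Set} {x y : A} {xs : List A} → x ∉ xs ∷ʳ y → x ∉ xs × x ≢ y
∉-∷ʳ⁻ {xs = xs} x∉ = x∉ ∘ ∈-++⁺ˡ , λ { refl → x∉ (∈-++⁺ʳ xs (here refl)) }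

module _ (G : Graph) where
  open Graph G
  open LexDFS G
  open DecMembership (Fin._≟_ {n}) using (_∈?_)

  initialLabel-source : initialLabel source ≡ ⊤⁺ ∷ []
  initialLabel-source =
    cong (λ b → if b then ⊤⁺ ∷ [] else []) (dec-true (source Fin.≟ source) refl)

  initialLabel-other : ∀ {v} → v ≢ source → initialLabel v ≡ []
  initialLabel-other {v} v≢s =
    cong (λ b → if b then ⊤⁺ ∷ [] else []) (dec-false (v Fin.≟ source) v≢s)

  module _ {i : ℕ} {u : V} {σ : List V} {label : V → Word} {w : V} where

    prepend-neighbour : w ∉ σ → Edge u w → prepend i u σ label w ≡ [ i ] ∷ label w
    prepend-neighbour w∉σ e =
      trans (cong (λ b → if b ∧ not (does (w ∈? σ)) then [ i ] ∷ label w else label w)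
                  (Equivalence.to T-≡ e))
            (cong (λ b → if not b then [ i ] ∷ label w else label w)
                  (dec-false (w ∈? σ) w∉σ))

    prepend-other : ¬ Edge u w → prepend i u σ label w ≡ label w
    prepend-other ¬e with edge? u w
    ... | true  = ⊥-elim (¬e _)
    ... | false = refl

  -- Every other vertex starts with the empty word, which lies below the word `∞`; so the first
  -- vertex numbered is the source.
  maximal⇒source : ∀ {v} → ¬ (initialLabel v <ˡᵉˣ initialLabel source) → v ≡ source
  maximal⇒source {v} maximal = decidable-stable (v Fin.≟ source) λ v≢s →
    maximal (subst₂ _<ˡᵉˣ_ (sym (initialLabel-other v≢s)) (sym initialLabel-source) halt)

  source∈ : ∀ {i label σ} → Search (suc i) label σ → source ∈ σ
  source∈ (step v start _ maximal)       = here (sym (maximal⇒source (maximal source λ ())))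
  source∈ (step _ S@(step _ _ _ _) _ _) = ∈-++⁺ˡ (source∈ S)

  LettersUpTo : ℕ → Word → Set
  LettersUpTo i = All (λ a → ∃[ j ] j ≤ i × a ≡ [ j ])

  -- Only the source ever carries `∞`; any other letter is the number of a past iteration.
  letters : ∀ {i label σ} → Search i label σ → ∀ {w} → w ≢ source → LettersUpTo i (label w)
  letters start w≢s = subst (LettersUpTo 0) (sym (initialLabel-other w≢s)) []
  letters (step {i} {label} {σ} v S _ _) {w} w≢s = prepended _
    where
    older : LettersUpTo (suc i) (label w)
    older = All.map (λ (j , j≤i , eq) → j , ℕ.m≤n⇒m≤1+n j≤i , eq) (letters S w≢s)
    prepended : ∀ b → LettersUpTo (suc i) (if b then [ suc i ] ∷ label w else label w)
    prepended true  = (suc i , ℕ.≤-refl , refl) ∷ older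
    prepended false = older

  -- The first letter decides: `as` is empty or begins with a letter of at most `i`.
  fresh-letter-maximal : ∀ {i a as} → LettersUpTo i as →
                         ¬ ([ suc i ] ∷ a <ˡᵉˣ as)
  fresh-letter-maximal ((_ , j≤i , refl) ∷ _) (this [ i<j ]) = ℕ.<⇒≱ i<j (ℕ.m≤n⇒m≤1+n j≤i)
  fresh-letter-maximal ((_ , j≤i , refl) ∷ _) (next refl _)  = ℕ.<-irrefl refl j≤i

  -- Unnumbered vertices with equal keys must have equal labels, since the condition applies in both
  -- directions. The converse is not demanded, so the keys may break ties among labels.
  Consistent : (V → ℤ) → (V → Word) → List V → Set
  Consistent κ label σ =
    ∀ {x y} → x ∉ σ → y ∉ σ → κ y ℤ.≤ κ x → ¬ (label x <ˡᵉˣ label y)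

  -- The effect of `pushLoop` on the keys: consecutive counter values from `c + 1` on, in the order
  -- of `ws`.
  assign : (V → ℤ) → ℕ → List V → V → ℤ
  assign κ c []       = κ
  assign κ c (w ∷ ws) = assign (updateAt κ w (λ _ → + suc c)) (suc c) ws

  assign-∉ : ∀ {κ c x} ws → x ∉ ws → assign κ c ws x ≡ κ x
  assign-∉ []       _    = refl
  assign-∉ (w ∷ ws) x∉ws =
    trans (assign-∉ ws (x∉ws ∘ there)) (updateAt-minimal _ w _ (x∉ws ∘ here))

  assign-∈ : ∀ {κ c x} ws → Unique ws → x ∈ ws → + suc c ℤ.≤ assign κ c ws x
  assign-∈ (w ∷ ws) (w∉ws ∷ _) (here refl) = ℤ.≤-reflexive
    (sym (trans (assign-∉ ws (λ w∈ → All.lookup w∉ws w∈ refl)) (updateAt-updates w _)))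
  assign-∈ (w ∷ ws) (_ ∷ ws!) (there x∈ws) =
    ℤ.≤-trans (+≤+ (ℕ.n≤1+n _)) (assign-∈ ws ws! x∈ws)

  updateAt-≤ : ∀ {κ : V → ℤ} {c} w → (∀ x → κ x ℤ.≤ + c) →
               ∀ x → updateAt κ w (λ _ → + suc c) x ℤ.≤ + suc c
  updateAt-≤ {κ} {c} w κ≤c x with x Fin.≟ w
  ... | yes refl = ℤ.≤-reflexive (updateAt-updates w κ)
  ... | no  x≢w  = subst (ℤ._≤ + suc c) (sym (updateAt-minimal x w κ x≢w))
                         (ℤ.≤-trans (κ≤c x) (+≤+ (ℕ.n≤1+n c)))

  assign-≤ : ∀ {κ c} ws → (∀ x → κ x ℤ.≤ + c) → ∀ x → assign κ c ws x ℤ.≤ + (length ws + c)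
  assign-≤ [] κ≤c = κ≤c
  assign-≤ {κ} {c} (w ∷ ws) κ≤c x =
    subst (λ k → assign κ c (w ∷ ws) x ℤ.≤ + k) (ℕ.+-suc (length ws) c)
          (assign-≤ ws (updateAt-≤ w κ≤c) x)

  -- New keys increase strictly along `ws`, so comparing them compares positions, and `R` relates
  -- earlier entries to later ones. With the order of the old keys as `R`, this says that the
  -- relative order of the neighbours is not upset.
  assign-reflects : ∀ {κ c x y ws} {R : V → V → Set} → (∀ {x} → R x x) →
                    Unique ws → AllPairs R ws → x ∈ ws → y ∈ ws →
                    assign κ c ws y ℤ.≤ assign κ c ws x → R y x
  assign-reflects rfl _ _ (here refl) (here refl) _ = rfl
  assign-reflects {κ} {c} {y = y} {ws = w ∷ ws} _ (w∉ws ∷ ws!) _ (here refl) (there y∈) y≤x =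
    ⊥-elim (ℤ.<-irrefl refl (ℤ.<-≤-trans (ℤ.+<+ (ℕ.n<1+n (suc c)))
      (ℤ.≤-trans (assign-∈ ws ws! y∈) (subst (assign κ c (w ∷ ws) y ℤ.≤_)
        (trans (assign-∉ ws (λ w∈ → All.lookup w∉ws w∈ refl)) (updateAt-updates w _)) y≤x))))
  assign-reflects _ _ (wR ∷ _) (there x∈) (here refl) _ = All.lookup wR x∈
  assign-reflects rfl (_ ∷ ws!) (_ ∷ wsR) (there x∈) (there y∈) y≤x =
    assign-reflects rfl ws! wsR x∈ y∈ y≤x

  -- Only the source has a nonempty label, so it is the only possible `y`; but then `x` has a key at
  -- least as large, hence is the source too.
  Consistent-initial : ∀ {κ} → (∀ x → κ source ℤ.≤ κ x → x ≡ source) →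
                       Consistent κ initialLabel []
  Consistent-initial κs-max {x} {y} _ _ κy≤κx x<y with y Fin.≟ source
  ... | no y≢s   = nothing-below-[] x<y
    where
    nothing-below-[] : ∀ {as} → ¬ (as <ˡᵉˣ [])
    nothing-below-[] (base ())
  ... | yes refl = irrefl (subst₂ _<ˡᵉˣ_ (trans (cong initialLabel (κs-max x κy≤κx)) initialLabel-source)
                                 refl x<y)
    where
    irrefl : ¬ (⊤⁺ ∷ [] <ˡᵉˣ ⊤⁺ ∷ [])
    irrefl (this ())
    irrefl (next _ (base ()))

  -- Four cases, by which of `x` and `y` are neighbours of `u`. If both are, the common first letter
  -- cancels and the order of the old keys survives because `ws` is sorted. If only `x` is, its
  -- fresh letter wins. If only `y` is, its new key exceeds that of `x`, against the assumption. If
  -- neither is, nothing has changed.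
  Consistent-step : ∀ {κ c label σ u ws i} →
    Search (suc i) (prepend (suc i) u (σ ∷ʳ u) label) (σ ∷ʳ u) →
    Search i label σ →
    (∀ {w} → Edge u w → w ∈ ws) → (∀ {w} → w ∈ ws → Edge u w) →
    Unique ws → AllPairs (λ x y → κ x ℤ.≤ κ y) ws → (∀ x → κ x ℤ.≤ + c) →
    Consistent κ label σ →
    Consistent (assign κ c ws) (prepend (suc i) u (σ ∷ʳ u) label) (σ ∷ʳ u)
  Consistent-step {κ} {c} {label} {σ} {u} {ws} {i} S′ S ⊆ws ws⊆ ws! ws↗ κ≤c con {x} {y} x∉ y∉ y≤x
    with T? (edge? u x) | T? (edge? u y)
  ... | yes ex | yes ey
        rewrite prepend-neighbour {suc i} {u} {σ ∷ʳ u} {label} x∉ ex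
              | prepend-neighbour {suc i} {u} {σ ∷ʳ u} {label} y∉ ey = λ where
          (this [ i<i ]) → ℕ.<-irrefl refl i<i
          (next _ x<y)   →
            con (proj₁ (∉-∷ʳ⁻ x∉)) (proj₁ (∉-∷ʳ⁻ y∉))
                (assign-reflects ℤ.≤-refl ws! ws↗ (⊆ws ex) (⊆ws ey) y≤x) x<y
  ... | yes ex | no ¬ey
        rewrite prepend-neighbour {suc i} {u} {σ ∷ʳ u} {label} x∉ ex
              | prepend-other {suc i} {u} {σ ∷ʳ u} {label} ¬ey =
          -- The source is numbered once this step is done, so `y` is another vertex and its label
          -- has no letter `∞`.
          fresh-letter-maximal (letters S λ { refl → y∉ (source∈ S′) })
  ... | no ¬ex | yes ey = ⊥-elim (ℤ.<-irrefl refl (ℤ.<-≤-trans (ℤ.+<+ (ℕ.n<1+n c))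
          (ℤ.≤-trans (assign-∈ ws ws! (⊆ws ey)) (ℤ.≤-trans y≤x
            (subst (ℤ._≤ + c) (sym (assign-∉ ws (¬ex ∘ ws⊆))) (κ≤c x))))))
  ... | no ¬ex | no ¬ey
        rewrite prepend-other {suc i} {u} {σ ∷ʳ u} {label} ¬ex
              | prepend-other {suc i} {u} {σ ∷ʳ u} {label} ¬ey =
          con (proj₁ (∉-∷ʳ⁻ x∉)) (proj₁ (∉-∷ʳ⁻ y∉))
              (subst₂ ℤ._≤_ (assign-∉ ws (¬ey ∘ ws⊆)) (assign-∉ ws (¬ex ∘ ws⊆)) y≤x)

  -- Some occurrence of w in the stack S has only keys of at least κ w above it. If this holds
  -- of every unnumbered w, then an unnumbered top of S has the largest key among them.
  data Reach (κ : V → ℤ) (w : V) : List V → Set where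
    here  : ∀ {S} → Reach κ w (w ∷ S)
    there : ∀ {u S} → κ w ℤ.≤ κ u → Reach κ w S → Reach κ w (u ∷ S)

  Reach-top : ∀ {κ w u S} → Reach κ w (u ∷ S) → κ w ℤ.≤ κ u
  Reach-top here         = ℤ.≤-refl
  Reach-top (there le _) = le

  Reach-pop : ∀ {κ w u S} → w ≢ u → Reach κ w (u ∷ S) → Reach κ w S
  Reach-pop w≢u here        = ⊥-elim (w≢u refl)
  Reach-pop _   (there _ r) = r

  ∈⇒Reach : ∀ {κ w S} → (∀ x → κ w ℤ.≤ κ x) → w ∈ S → Reach κ w S
  ∈⇒Reach κw-min (here refl) = here
  ∈⇒Reach κw-min (there w∈S) = there (κw-min _) (∈⇒Reach κw-min w∈S)

  -- For `x = w` the new top is itself the required occurrence. Otherwise the key of `x` is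
  -- unchanged, the new top has a larger key, and the keys further down can only have grown.
  Reach-push : ∀ {κ c w S x} → (∀ x → κ x ℤ.≤ + c) → Reach κ x S →
               Reach (updateAt κ w (λ _ → + suc c)) x (w ∷ S)
  Reach-push {κ} {c} {w} {x = x} κ≤c r with x Fin.≟ w
  ... | yes refl = here
  ... | no x≢w = there
          (ℤ.≤-trans (updateAt-≤ w κ≤c x) (ℤ.≤-reflexive (sym (updateAt-updates w κ))))
          (raise r)
    where
    grows : ∀ v → κ v ℤ.≤ updateAt κ w (λ _ → + suc c) v
    grows v with v Fin.≟ w
    ... | yes refl = ℤ.≤-trans (κ≤c v) (ℤ.≤-trans (+≤+ (ℕ.n≤1+n c))
                       (ℤ.≤-reflexive (sym (updateAt-updates w κ))))
    ... | no v≢w   = ℤ.≤-reflexive (sym (updateAt-minimal v w κ v≢w))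
    raise : ∀ {S} → Reach κ x S → Reach (updateAt κ w (λ _ → + suc c)) x S
    raise here         = here
    raise (there {u} le r) =
      there (subst (ℤ._≤ updateAt κ w (λ _ → + suc c) u) (sym (updateAt-minimal x w κ x≢w))
                   (ℤ.≤-trans le (grows u)))
            (raise r)

  Reach-assign : ∀ {κ c x S} ws → (∀ x → κ x ℤ.≤ + c) → Reach κ x S →
                 Reach (assign κ c ws) x (ws ʳ++ S)
  Reach-assign []       _   r = r
  Reach-assign (w ∷ ws) κ≤c r = Reach-assign ws (updateAt-≤ w κ≤c) (Reach-push κ≤c r)

-- Lengths and sums of extended lists.

length-∷ʳ : {A : Set} (xs : List A) {x : A} → length (xs ∷ʳ x) ≡ suc (length xs)
length-∷ʳ xs = trans (length-++ xs) (ℕ.+-comm (length xs) 1)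

sum-map-∷ʳ : {A : Set} (f : A → ℕ) (xs : List A) {x : A} →
             sum (map f (xs ∷ʳ x)) ≡ f x + sum (map f xs)
sum-map-∷ʳ f xs = sum-↭ (↭.map⁺ f (↭-sym (∷↭∷ʳ _ xs)))

sum-map-affine : {A : Set} (f : A → ℕ) (a b : ℕ) (xs : List A) →
                 sum (map (λ x → a + f x * b) xs) ≡ a * length xs + sum (map f xs) * b
sum-map-affine f a b []       = sym (trans (ℕ.+-identityʳ (a * 0)) (ℕ.*-zeroʳ a))
sum-map-affine f a b (x ∷ xs) = trans (cong (λ s → a + f x * b + s) (sum-map-affine f a b xs))
                                      (regroup a (f x) b (length xs) (sum (map f xs)))
  where
  regroup : ∀ a y b l s → a + y * b + (a * l + s * b) ≡ a * suc l + (y + s) * b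
  regroup = solve-∀

Unique-∷ʳ : {A : Set} {x : A} {xs : List A} → Unique xs → x ∉ xs → Unique (xs ∷ʳ x)
Unique-∷ʳ xs! x∉xs = Unique.++⁺ xs! ([] ∷ []) λ { (x∈xs , here refl) → x∉xs x∈xs }

-- The invariant of the search.

module _ {G : Graph} (A : AdjacencyLists G) where
  open Graph G
  open AdjacencyLists A
  open Degrees A
  open LexDFS G hiding (IsLexDFSOrdering)
  open DecMembership (Fin._≟_ {n}) using (_∈?_)

  search-unique : ∀ {i label σ} → Search i label σ → Unique σ
  search-unique start            = []
  search-unique (step v S v∉σ _) = Unique-∷ʳ (search-unique S) v∉σ

  degrees : List V → ℕ
  degrees σ = sum (map degree σ)

  -- The labels appear only here, as witnesses of an execution of LexDFS; the program stores keys
  -- alone. By `count`, the counter is the degree sum of the numbered vertices, which bounds both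
  -- the keys and the number of pushes.
  record Valid (κ : V → ℤ) (c : ℕ) (σ S : List V) : Set where
    field
      label      : V → Word
      search     : Search (length σ) label σ
      consistent : Consistent G κ label σ
      bound      : ∀ x → κ x ℤ.≤ + c
      count      : c ≡ degrees σ
      reach      : ∀ {w} → w ∉ σ → Reach G κ w S

    σ! : Unique σ
    σ! = search-unique search

    degrees≤ : degrees σ ≤ degrees (allFin n)
    degrees≤ = sum-mono-⊆ degree σ! (λ _ → ∈-allFin _)

    length≤n : length σ ≤ n
    length≤n = subst (length σ ≤_) (List.length-tabulate id)
                     (length-mono-⊆ σ! (λ _ → ∈-allFin _))

  open Valid

  Valid-initial : ∀ {κ S} → (∀ x → κ x ℤ.≤ + 0) → (∀ x → κ source ℤ.≤ κ x → x ≡ source) →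
                  (∀ w → Reach G κ w S) → Valid κ 0 [] S
  Valid-initial κ≤0 κs-max r = record
    { label      = initialLabel
    ; search     = start
    ; consistent = Consistent-initial G κs-max
    ; bound      = κ≤0
    ; count      = refl
    ; reach      = λ _ → r _
    }

  Valid-pop : ∀ {κ c σ u S} → u ∈ σ → Valid κ c σ (u ∷ S) → Valid κ c σ S
  Valid-pop u∈σ v = record
    { Valid v
    ; reach = λ w∉σ → Reach-pop G (λ { refl → w∉σ u∈σ }) (reach v w∉σ)
    }

  -- `ws` may be any rearrangement of the neighbours with nondecreasing old keys, because the
  -- machine's sort promises nothing about ties.
  Valid-visit : ∀ {κ c σ u S ws} → u ∉ σ → Valid κ c σ (u ∷ S) →
                ws ↭ neighbours u → AllPairs (λ x y → κ x ℤ.≤ κ y) ws →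
                Valid (assign G κ c ws) (length ws + c) (σ ∷ʳ u) (ws ʳ++ S)
  Valid-visit {κ} {c} {σ} {u} {S} {ws} u∉σ v ws↭ ws↗ = record
    { label      = label′
    ; search     = subst (λ i → Search i label′ (σ ∷ʳ u)) (sym (length-∷ʳ σ)) search′
    ; consistent = Consistent-step G search′ (search v)
        (λ e → ∈-resp-↭ (↭-sym ws↭) (Equivalence.from (complete u _) e))
        (λ w∈ → Equivalence.to (complete u _) (∈-resp-↭ ws↭ w∈))
        (↭ₛ.Unique-resp-↭ (setoid V) (↭⇒↭ₛ (↭-sym ws↭)) (unique u))
        ws↗ (bound v) (consistent v)
    ; bound      = assign-≤ G ws (bound v)
    ; count      = begin
        length ws + c               ≡⟨ cong (ℕ._+ c) (↭-length ws↭) ⟩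
        degree u + c                ≡⟨ cong (degree u ℕ.+_) (count v) ⟩
        degree u + degrees σ        ≡⟨ sum-map-∷ʳ degree σ ⟨
        degrees (σ ∷ʳ u)            ∎
    ; reach      = λ w∉ → let w∉σ , w≢u = ∉-∷ʳ⁻ w∉ in
        Reach-assign G ws (bound v) (Reach-pop G w≢u (reach v w∉σ))
    }
    where
    open ≡-Reasoning
    label′ : V → Word
    label′ = prepend (suc (length σ)) u (σ ∷ʳ u) (label v)
    search′ : Search (suc (length σ)) label′ (σ ∷ʳ u)
    -- `u` is on top and unnumbered, so by `reach` no unnumbered vertex has a larger key, and by
    -- `consistent` none has a larger label: LexDFS may choose `u`.
    search′ = step u (search v) u∉σ λ w w∉σ →
      consistent v u∉σ w∉σ (Reach-top G (reach v w∉σ))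

  -- No vertex can have an occurrence in the empty stack, so `reach` leaves none unnumbered.
  Valid-empty : ∀ {κ c σ} → Valid κ c σ [] → length σ ≡ n × IsLexDFSOrdering G σ
  Valid-empty {κ} {c} {σ} v = σ-full , label v , subst (λ i → Search i (label v) σ) σ-full (search v)
    where
    all∈σ : ∀ w → w ∈ σ
    all∈σ w = decidable-stable (w ∈? σ) λ w∉σ → case-empty (reach v w∉σ)
      where
      case-empty : ¬ Reach G κ w []
      case-empty ()
    σ-full : length σ ≡ n
    σ-full = ℕ.≤-antisym (length≤n v)
      (subst (_≤ length σ) (List.length-tabulate id)
             (length-mono-⊆ (Unique.allFin⁺ n) (λ {w} _ → all∈σ w)))

-- Heaps and execution

-- A total counterpart of `set` that changes nothing out of range, so that updated heaps can be
-- written as plain terms.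
put : ℕ → A → List A → List A
put _       _ []       = []
put zero    y (_ ∷ xs) = y ∷ xs
put (suc i) y (x ∷ xs) = x ∷ put i y xs

set-put : ∀ i {x y : A} xs → xs ‼ i ≡ just x → set i y xs ≡ just (put i y xs)
set-put zero    (_ ∷ xs) _ = refl
set-put (suc i) {y = y} (_ ∷ xs) e rewrite set-put i {y = y} xs e = refl

‼-put : ∀ i {x y : A} xs → xs ‼ i ≡ just x → put i y xs ‼ i ≡ just y
‼-put zero    (_ ∷ xs) _ = refl
‼-put (suc i) (_ ∷ xs) e = ‼-put i xs e

‼-put-≢ : ∀ {i j} {y : A} xs → j ≢ i → put i y xs ‼ j ≡ xs ‼ j
‼-put-≢                         []       _   = refl
‼-put-≢ {i = zero}  {j = zero}  (_ ∷ xs) 0≢0 = ⊥-elim (0≢0 refl)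
‼-put-≢ {i = zero}  {j = suc j} (_ ∷ xs) _   = refl
‼-put-≢ {i = suc i} {j = zero}  (_ ∷ xs) _   = refl
‼-put-≢ {i = suc i} {j = suc j} (_ ∷ xs) j≢i = ‼-put-≢ xs (j≢i ∘ cong suc)

‼-∷ʳ-new : ∀ {i} {x : A} xs → length xs ≡ i → (xs ∷ʳ x) ‼ i ≡ just x
‼-∷ʳ-new []       refl = refl
‼-∷ʳ-new (_ ∷ xs) refl = ‼-∷ʳ-new xs refl

‼-∷ʳ-old : ∀ i {x y : A} xs → xs ‼ i ≡ just x → (xs ∷ʳ y) ‼ i ≡ just x
‼-∷ʳ-old zero    (_ ∷ xs) e = e
‼-∷ʳ-old (suc i) (_ ∷ xs) e = ‼-∷ʳ-old i xs e

‼-tabulate : ∀ {n} (f : Fin n → A) i → tabulate f ‼ toℕ i ≡ just (f i)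
‼-tabulate f zero    = refl
‼-tabulate f (suc i) = ‼-tabulate (f ∘ suc) i

put-tabulate : ∀ {n} (g : A → B) (f : Fin n → A) i y →
               put (toℕ i) (g y) (tabulate (g ∘ f)) ≡ tabulate (g ∘ updateAt f i (λ _ → y))
put-tabulate g f zero    y = refl
put-tabulate g f (suc i) y = cong (_ ∷_) (put-tabulate g (f ∘ suc) i y)

replicate≡tabulate : ∀ n (x : A) → replicate n x ≡ tabulate {n = n} (λ _ → x)
replicate≡tabulate zero    x = refl
replicate≡tabulate (suc n) x = cong (x ∷_) (replicate≡tabulate n x)

‼-map-++ : ∀ (g : A → B) xs {y ys} → (map g xs ++ y ∷ ys) ‼ length xs ≡ just y
‼-map-++ g []       = refl
‼-map-++ g (_ ∷ xs) = ‼-map-++ g xs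

put-map-++ : ∀ (g : A → B) xs x {y ys} →
             put (length xs) (g x) (map g xs ++ y ∷ ys) ≡ map g (xs ∷ʳ x) ++ ys
put-map-++ g []       x = refl
put-map-++ g (y ∷ xs) x = cong (g y ∷_) (put-map-++ g xs x)

map-proj₂-zip : (xs : List A) (ys : List B) → length xs ≡ length ys → map proj₂ (zip xs ys) ≡ ys
map-proj₂-zip []       []       _ = refl
map-proj₂-zip (_ ∷ xs) (y ∷ ys) e = cong (y ∷_) (map-proj₂-zip xs ys (ℕ.suc-injective e))

cell : ∀ {n} → ℕ × Fin n → Node
cell = Product.map₂ vertex

adjacencyList-cells : ∀ {n} (ws : List (Fin n)) →
  ∃[ kws ] adjacencyList ws ≡ dll (length ws) (map cell kws) × map proj₂ kws ≡ ws
adjacencyList-cells ws = zip (upTo (length ws)) ws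
  , cong (dll (length ws))
      (trans (cong (λ ks → zip ks (map vertex ws)) (sym (List.map-id (upTo (length ws)))))
             (List.zip-map id vertex (upTo (length ws)) ws))
  , map-proj₂-zip (upTo (length ws)) ws (List.length-upTo (length ws))

module _ {n : ℕ} (κ : Fin n → ℤ) where

  private
    keyed : ℕ × Fin n → ℤ × Node
    keyed (k , w) = κ w , k , vertex w

    keyOrder = On.decTotalOrder {B = ℤ × Node} ℤ.≤-decTotalOrder proj₁

  withKeys-cells : ∀ kws → withKeys (tabulate (int ∘ κ)) (map cell kws) ≡ just (map keyed kws)
  withKeys-cells []              = refl
  withKeys-cells ((_ , w) ∷ kws)
    rewrite ‼-tabulate (int ∘ κ) w | withKeys-cells kws = refl

  -- Only that the abstract sort yields a sorted permutation is used. A permutation of a mapped list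
  -- is the image of a permuted list, so the sorted nodes still come from vertices.
  sortKeyed-cells : ∀ kws → ∃[ kws′ ]
    map proj₂ (sortKeyed (map keyed kws)) ≡ map cell kws′ ×
    map proj₂ kws′ ↭ map proj₂ kws ×
    AllPairs (λ x y → κ x ℤ.≤ κ y) (map proj₂ kws′)
  sortKeyed-cells kws
    with kws′ , eq , kws↭kws′ ← ↭.↭-map-inv keyed (↭-sym (Sort.sort-↭ keyOrder (map keyed kws)))
    = kws′
    , trans (cong (map proj₂) eq) (sym (List.map-∘ kws′))
    , ↭.map⁺ proj₂ (↭-sym kws↭kws′)
    , AllPairs.map⁺ (AllPairs.map⁻ (subst (AllPairs _) eq
        (Sorted⇒AllPairs (On.totalOrder ℤ.≤-totalOrder proj₁) (Sort.sort-↗ keyOrder (map keyed kws)))))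

-- A program logic with running times.

module Execution (W : ℕ) where
  open Machine W

  bounded-≤ : ∀ {z} → ℤ.∣ z ∣ ≤ W → bounded z ≡ just z
  bounded-≤ {z} ∣z∣≤W =
    cong (if_then just z else nothing) (Equivalence.to T-≡ (ℕ.≤⇒≤ᵇ ∣z∣≤W))

  -- Kept opaque so that states are inferred by unification instead of unfolding exec.
  opaque
    Executes : Instr → State → State → ℕ → Set
    Executes i s s₁ t = exec i s ≡ just (s₁ , t)

    Tests : Cond → State → Bool → Set
    Tests b s r = test b s ≡ just r

  module _ {ρ : Reg → Val} {h : Heap} where
    opaque
      unfolding Executes Tests

      exec-const : ∀ {x z} → ℤ.∣ z ∣ ≤ W →
                   Executes (const x z) ⟨ ρ , h ⟩ ⟨ ρ [ x ↦ int z ] , h ⟩ 1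
      exec-const {z = z} b rewrite bounded-≤ {z} b = refl

      exec-setNil : ∀ {x} → Executes (setNil x) ⟨ ρ , h ⟩ ⟨ ρ [ x ↦ nil ] , h ⟩ 1
      exec-setNil = refl

      exec-copy : ∀ {x y} → Executes (copy x y) ⟨ ρ , h ⟩ ⟨ ρ [ x ↦ ρ y ] , h ⟩ 1
      exec-copy = refl

      exec-incr : ∀ {x c} → ρ x ≡ int (+ c) → suc c ≤ W →
                  Executes (incr x) ⟨ ρ , h ⟩ ⟨ ρ [ x ↦ int (+ suc c) ] , h ⟩ 1
      exec-incr {c = c} x≡ b rewrite x≡ | bounded-≤ {+ suc c} b = refl

      exec-newArray : ∀ {x size init k u ℓ} → ρ size ≡ int (+ k) → ρ init ≡ u → length h ≡ ℓ →
        Executes (newArray x size init) ⟨ ρ , h ⟩ ⟨ ρ [ x ↦ ref ℓ ] , h ∷ʳ array (replicate k u) ⟩ (suc k)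
      exec-newArray size≡ init≡ refl rewrite size≡ | init≡ = refl

      exec-newList : ∀ {x ℓ} → length h ≡ ℓ →
        Executes (newList x) ⟨ ρ , h ⟩ ⟨ ρ [ x ↦ ref ℓ ] , h ∷ʳ dll 0 [] ⟩ 1
      exec-newList refl = refl

      exec-read : ∀ {x a i ℓ us j u} → ρ a ≡ ref ℓ → h ‼ ℓ ≡ just (array us) →
        ρ i ≡ int (+ j) → us ‼ j ≡ just u →
        Executes (read x a i) ⟨ ρ , h ⟩ ⟨ ρ [ x ↦ u ] , h ⟩ 1
      exec-read a≡ us≡ i≡ u≡ rewrite a≡ | us≡ | i≡ | u≡ = refl

      exec-write : ∀ {a i y ℓ us j u v} → ρ a ≡ ref ℓ → h ‼ ℓ ≡ just (array us) →
        ρ i ≡ int (+ j) → us ‼ j ≡ just u → ρ y ≡ v →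
        Executes (write a i y) ⟨ ρ , h ⟩ ⟨ ρ , put ℓ (array (put j v us)) h ⟩ 1
      exec-write {ℓ = ℓ} {us} {j} {u} {v} a≡ us≡ i≡ u≡ y≡
        rewrite a≡ | us≡ | i≡ | y≡ | set-put j {y = v} us u≡
              | set-put ℓ {y = array (put j v us)} h us≡ = refl

      exec-first : ∀ {x l ℓ f ns} → ρ l ≡ ref ℓ → h ‼ ℓ ≡ just (dll f ns) →
        Executes (first x l) ⟨ ρ , h ⟩ ⟨ ρ [ x ↦ toNode ℓ (List.head ns) ] , h ⟩ 1
      exec-first l≡ ns≡ rewrite l≡ | ns≡ = refl

      -- Stated for the first node of a list: the program reads and removes nodes only there, so
      -- that every list is used as a stack.
      exec-value : ∀ {x p ℓ f k u ns} → ρ p ≡ node ℓ k → h ‼ ℓ ≡ just (dll f ((k , u) ∷ ns)) →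
        Executes (value x p) ⟨ ρ , h ⟩ ⟨ ρ [ x ↦ u ] , h ⟩ 1
      exec-value {k = k} p≡ ns≡
        rewrite p≡ | ns≡ | Equivalence.to T-≡ (ℕ.≡⇒≡ᵇ k k refl) = refl

      exec-remove : ∀ {p ℓ f k u ns} → ρ p ≡ node ℓ k → h ‼ ℓ ≡ just (dll f ((k , u) ∷ ns)) →
        Executes (remove p) ⟨ ρ , h ⟩ ⟨ ρ , put ℓ (dll f ns) h ⟩ 1
      exec-remove {ℓ = ℓ} {f} {k} {ns = ns} p≡ ns≡
        rewrite p≡ | ns≡ | Equivalence.to T-≡ (ℕ.≡⇒≡ᵇ k k refl)
              | set-put ℓ {y = dll f ns} h ns≡ = refl

      exec-pushFront : ∀ {l y ℓ f u ns} → ρ l ≡ ref ℓ → h ‼ ℓ ≡ just (dll f ns) → ρ y ≡ u →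
        Executes (pushFront l y) ⟨ ρ , h ⟩ ⟨ ρ , put ℓ (dll (suc f) ((f , u) ∷ ns)) h ⟩ 1
      exec-pushFront {ℓ = ℓ} {f} {u} {ns} l≡ ns≡ y≡
        rewrite l≡ | ns≡ | y≡ | set-put ℓ {y = dll (suc f) ((f , u) ∷ ns)} h ns≡ = refl

      exec-sortBy : ∀ {l a ℓ f ns ℓ′ us zns} → ρ l ≡ ref ℓ → h ‼ ℓ ≡ just (dll f ns) →
        ρ a ≡ ref ℓ′ → h ‼ ℓ′ ≡ just (array us) → withKeys us ns ≡ just zns →
        Executes (sortBy l a) ⟨ ρ , h ⟩ ⟨ ρ , put ℓ (dll f (map proj₂ (sortKeyed zns))) h ⟩
                 (1 + length ns * ⌈log₂ length ns ⌉)
      exec-sortBy {ℓ = ℓ} {f} {zns = zns} l≡ ns≡ a≡ us≡ zns≡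
        rewrite l≡ | ns≡ | a≡ | us≡ | zns≡
              | set-put ℓ {y = dll f (map proj₂ (sortKeyed zns))} h ns≡ = refl

      test-isNil : ∀ {x} → ρ x ≡ nil → Tests (isNil x) ⟨ ρ , h ⟩ true
      test-isNil x≡ rewrite x≡ = refl

      test-isNil-ref : ∀ {x ℓ} → ρ x ≡ ref ℓ → Tests (isNil x) ⟨ ρ , h ⟩ false
      test-isNil-ref x≡ rewrite x≡ = refl

      test-nonNil-nil : ∀ {x} → ρ x ≡ nil → Tests (neg (isNil x)) ⟨ ρ , h ⟩ false
      test-nonNil-nil x≡ rewrite x≡ = refl

      test-nonNil-node : ∀ {x ℓ k} → ρ x ≡ node ℓ k → Tests (neg (isNil x)) ⟨ ρ , h ⟩ true
      test-nonNil-node x≡ rewrite x≡ = refl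

      test-less : ∀ {x y i j} → ρ x ≡ int (+ i) → ρ y ≡ int (+ j) →
                  Tests (less x y) ⟨ ρ , h ⟩ (does (+ i ℤ.<? + j))
      test-less x≡ y≡ rewrite x≡ | y≡ = refl

  -- A total-correctness triple whose postcondition also sees the elapsed time. In the rules for
  -- composition, the postcondition of the first part is the triple of the rest, with the time
  -- already spent added.
  record Terminates (c : Cmd) (s : State) (Q : State → ℕ → Set) : Set where
    constructor terminates
    field
      {final} : State
      {time}  : ℕ
      run     : c , s ⇓ final ∣ time
      post    : Q final time

  private
    variable
      b     : Cond
      c d   : Cmd
      i     : Instr
      s s₁  : State
      t₁    : ℕ
      Q Q′  : State → ℕ → Set

  weaken : (∀ {s t} → Q s t → Q′ s t) → Terminates c s Q → Terminates c s Q′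
  weaken f (terminates r q) = terminates r (f q)

  opaque
    unfolding Executes
    execute : Executes i s s₁ t₁ → Q s₁ t₁ → Terminates (instr i) s Q
    execute e q = terminates (⇓-instr e) q

  skip-rule : Q s 1 → Terminates skip s Q
  skip-rule q = terminates ⇓-skip q

  seq-rule : Terminates c s (λ s₁ t₁ → Terminates d s₁ (λ s₂ t₂ → Q s₂ (t₁ + t₂))) →
             Terminates (c ⨟ d) s Q
  seq-rule (terminates r (terminates r′ q)) = terminates (⇓-seq r r′) q

  step-rule : Executes i s s₁ t₁ → Terminates d s₁ (λ s₂ t₂ → Q s₂ (t₁ + t₂)) →
              Terminates (instr i ⨟ d) s Q
  step-rule e T = seq-rule (execute e T)

  opaque
    unfolding Tests

    then-rule : Tests b s true → Terminates c s (λ s₁ t → Q s₁ (1 + t)) →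
                Terminates (ifᶜ b c d) s Q
    then-rule e (terminates r q) = terminates (⇓-then e r) q

    else-rule : Tests b s false → Terminates d s (λ s₁ t → Q s₁ (1 + t)) →
                Terminates (ifᶜ b c d) s Q
    else-rule e (terminates r q) = terminates (⇓-else e r) q

    stop-rule : Tests b s false → Q s 1 → Terminates (while b c) s Q
    stop-rule e q = terminates (⇓-stop e) q

    loop-rule : Tests b s true →
      Terminates c s (λ s₁ t₁ → Terminates (while b c) s₁ (λ s₂ t₂ → Q s₂ (1 + t₁ + t₂))) →
      Terminates (while b c) s Q
    loop-rule e (terminates r (terminates r′ q)) = terminates (⇓-loop e r r′) q

-- The program

%adj %n %source %counter %keys %out %stack %pos %cursor %v %list %nil : Reg
%adj     = 0
%n       = 1
%source  = 2
%counter = 3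
%keys    = 4
%out     = 5
%stack   = 6
%pos     = 7
%cursor  = 8
%v       = 9
%list    = 10
%nil     = 11

-- The entry of a vertex in the array of neighbour lists becomes nil once it is numbered.
fillLoop pushLoop searchLoop program : Cmd

fillLoop = while (less %pos %n) (
  instr (pushFront %stack %pos) ⨟
  instr (incr %pos))

pushLoop = while (neg (isNil %cursor)) (
  instr (value %v %cursor) ⨟
  instr (remove %cursor) ⨟
  instr (incr %counter) ⨟
  instr (write %keys %v %counter) ⨟
  instr (pushFront %stack %v) ⨟
  instr (first %cursor %list))

searchLoop = while (neg (isNil %cursor)) (
  instr (value %v %cursor) ⨟
  instr (remove %cursor) ⨟
  instr (read %list %adj %v) ⨟
  ifᶜ (isNil %list) skip (
    instr (write %adj %v %nil) ⨟
    instr (write %out %pos %v) ⨟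
    instr (incr %pos) ⨟
    instr (sortBy %list %keys) ⨟
    instr (first %cursor %list) ⨟
    pushLoop) ⨟
  instr (first %cursor %stack))

program =
  instr (setNil %nil) ⨟
  -- For now `%counter` only supplies the initial key -1; it is reset to 0 before counting begins.
  instr (const %counter -[1+ 0 ]) ⨟
  instr (newArray %keys %n %counter) ⨟
  instr (newArray %out %n %nil) ⨟
  instr (newList %stack) ⨟
  instr (const %counter (+ 0)) ⨟
  instr (write %keys %source %counter) ⨟
  instr (const %pos (+ 0)) ⨟
  fillLoop ⨟
  -- The source goes on top of all vertices, itself included, and is therefore visited first.
  instr (pushFront %stack %source) ⨟
  instr (const %pos (+ 0)) ⨟
  instr (first %cursor %stack) ⨟
  searchLoop ⨟
  -- `%adj` is register 0, where the output is expected.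
  instr (copy %adj %out)

-- Correctness and running time of the program.

module Correctness {G : Graph} (A : AdjacencyLists G) where
  open Graph G
  open AdjacencyLists A
  open Degrees A

  -- `D` bounds the counter and every single degree, so `Λ` bounds the logarithm charged in any of
  -- the sorts.
  W D Λ : ℕ
  W = wordBound G
  D = degrees A (allFin n)
  Λ = ⌈log₂ D ⌉

  open Execution W

  n≤W : n ≤ W
  n≤W = ℕ.m≤m⊔n n (2 * m)

  D≤W : D ≤ W
  D≤W = ℕ.≤-trans sum-degree≤2m (ℕ.m≤n⊔m n (2 * m))

  listAt : V → ℕ
  listAt v = suc (toℕ v)

  -- The input occupies the addresses 0 to n; the objects allocated by the program follow in this
  -- order.
  keysAt outAt stackAt : ℕ
  keysAt  = suc n
  outAt   = 2 + n
  stackAt = 3 + n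

  -- The values 0, 1 and 2 of `k` give `keysAt`, `outAt` and `stackAt` by computation.
  listAt≢ : ∀ k {v} → listAt v ≢ k + suc n
  listAt≢ k {v} = ℕ.<⇒≢ (ℕ.≤-trans (s≤s (Fin.toℕ<n v)) (ℕ.m≤n+m (suc n) k))

  later≢ : ∀ k {a} → a ≢ suc k + a
  later≢ k {a} = ℕ.m≢1+n+m a {k}

  listAt-injective : ∀ {v w} → v ≢ w → listAt v ≢ listAt w
  listAt-injective v≢w = v≢w ∘ Fin.toℕ-injective ∘ ℕ.suc-injective

  -- The machine state in terms of the search.

  record Registers (ρ : Reg → Val) (c p : ℕ) : Set where
    field
      adj≡     : ρ %adj     ≡ ref 0
      n≡       : ρ %n       ≡ int (+ n)
      source≡  : ρ %source  ≡ vertex source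
      counter≡ : ρ %counter ≡ int (+ c)
      keys≡    : ρ %keys    ≡ ref keysAt
      out≡     : ρ %out     ≡ ref outAt
      stack≡   : ρ %stack   ≡ ref stackAt
      pos≡     : ρ %pos     ≡ int (+ p)
      nil≡     : ρ %nil     ≡ nil

  -- The part `us` of the output array that is not yet written is arbitrary. The neighbour lists are
  -- left to `Linked`, since visits consume them.
  record Memory (h : Heap) (links : V → Val) (κ : V → ℤ) (σ : List V)
                (f : ℕ) (ks : List (ℕ × V)) : Set where
    field
      links‼ : h ‼ 0 ≡ just (array (tabulate links))
      keys‼  : h ‼ keysAt ≡ just (array (tabulate (int ∘ κ)))
      out‼   : ∃[ us ] h ‼ outAt ≡ just (array (map vertex σ ++ us)) × length σ + length us ≡ n
      stack‼ : h ‼ stackAt ≡ just (dll f (map cell ks))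

  open Registers
  open Memory

  module _ {h links κ σ f ks} (M : Memory h links κ σ f ks) where

    Memory-list : ∀ v {o} → Memory (put (listAt v) o h) links κ σ f ks
    Memory-list v = record
      { links‼ = trans (‼-put-≢ h λ ()) (links‼ M)
      ; keys‼  = trans (‼-put-≢ h (≢-sym (listAt≢ 0))) (keys‼ M)
      ; out‼   = let us , us≡ , len = out‼ M in
                 us , trans (‼-put-≢ h (≢-sym (listAt≢ 1))) us≡ , len
      ; stack‼ = trans (‼-put-≢ h (≢-sym (listAt≢ 2))) (stack‼ M)
      }

    Memory-link : ∀ u → Memory (put 0 (array (put (toℕ u) nil (tabulate links))) h)
                               (updateAt links u (λ _ → nil)) κ σ f ks
    Memory-link u = record
      { links‼ = trans (‼-put 0 h (links‼ M)) (cong (just ∘ array) (put-tabulate id links u nil))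
      ; keys‼  = trans (‼-put-≢ h λ ()) (keys‼ M)
      ; out‼   = let us , us≡ , len = out‼ M in us , trans (‼-put-≢ h λ ()) us≡ , len
      ; stack‼ = trans (‼-put-≢ h λ ()) (stack‼ M)
      }

    Memory-key : ∀ w z → Memory (put keysAt (array (put (toℕ w) (int z) (tabulate (int ∘ κ)))) h)
                                links (updateAt κ w (λ _ → z)) σ f ks
    Memory-key w z = record
      { links‼ = trans (‼-put-≢ h λ ()) (links‼ M)
      ; keys‼  = trans (‼-put keysAt h (keys‼ M)) (cong (just ∘ array) (put-tabulate int κ w z))
      ; out‼   = let us , us≡ , len = out‼ M in
                 us , trans (‼-put-≢ h (≢-sym (later≢ 0))) us≡ , len
      ; stack‼ = trans (‼-put-≢ h (≢-sym (later≢ 1))) (stack‼ M)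
      }

    Memory-out : ∀ u {x us} → h ‼ outAt ≡ just (array (map vertex σ ++ x ∷ us)) →
                 length σ + suc (length us) ≡ n →
                 Memory (put outAt (array (put (length σ) (vertex u) (map vertex σ ++ x ∷ us))) h)
                        links κ (σ ∷ʳ u) f ks
    Memory-out u {x} {us} us≡ len = record
      { links‼ = trans (‼-put-≢ h λ ()) (links‼ M)
      ; keys‼  = trans (‼-put-≢ h (later≢ 0)) (keys‼ M)
      ; out‼   = us
               , trans (‼-put outAt h us≡) (cong (just ∘ array) (put-map-++ vertex σ u))
               , trans (cong (_+ length us) (length-∷ʳ σ)) (trans (sym (ℕ.+-suc _ _)) len)
      ; stack‼ = trans (‼-put-≢ h (≢-sym (later≢ 0))) (stack‼ M)
      }

    Memory-stack : ∀ {f′ ks′} → Memory (put stackAt (dll f′ (map cell ks′)) h) links κ σ f′ ks′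
    Memory-stack = record
      { links‼ = trans (‼-put-≢ h λ ()) (links‼ M)
      ; keys‼  = trans (‼-put-≢ h (later≢ 1)) (keys‼ M)
      ; out‼   = let us , us≡ , len = out‼ M in
                 us , trans (‼-put-≢ h (later≢ 0)) us≡ , len
      ; stack‼ = ‼-put stackAt h (stack‼ M)
      }

  -- Pushing the neighbours of one vertex.

  record Pushed (h : Heap) (u : V) (links : V → Val) (κ : V → ℤ) (c : ℕ) (σ S : List V)
                (s : State) : Set where
    field
      {fresh}   : ℕ
      {cells}   : List (ℕ × V)
      registers : Registers (regs s) c (length σ)
      memory    : Memory (heap s) links κ σ fresh cells
      contents  : map proj₂ cells ≡ S
      frame     : ∀ {v} → v ≢ u → heap s ‼ listAt v ≡ h ‼ listAt v

  -- A round costs 7: the test and six instructions. It deletes the node it handles, so the list of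
  -- `u` ends up empty and `frame` speaks of the other lists only.
  pushLoop-correct : ∀ kws {ρ h u links κ c σ f f′ ks} →
    Registers ρ c (length σ) → Memory h links κ σ f ks →
    ρ %list ≡ ref (listAt u) → h ‼ listAt u ≡ just (dll f′ (map cell kws)) →
    ρ %cursor ≡ toNode (listAt u) (List.head (map cell kws)) →
    length (map proj₂ kws) + c ≤ W →
    Terminates pushLoop ⟨ ρ , h ⟩ λ s t →
      Pushed h u links (assign G κ c (map proj₂ kws)) (length (map proj₂ kws) + c) σ
             (map proj₂ kws ʳ++ map proj₂ ks) s ×
      t ≡ 1 + 7 * length (map proj₂ kws)
  pushLoop-correct [] R M list≡ list‼ cursor≡ _ = stop-rule (test-nonNil-nil cursor≡)
    (record { registers = R ; memory = M ; contents = refl ; frame = λ _ → refl } , refl)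
  pushLoop-correct ((k , w) ∷ kws) {ρ} {h} {u} {links} {κ} {c} {σ} {f} {f′} {ks} R M list≡ list‼ cursor≡ c≤W =
    loop-rule (test-nonNil-node cursor≡) (
    step-rule (exec-value cursor≡ list‼) (
    step-rule (exec-remove cursor≡ list‼) (
    step-rule (exec-incr (counter≡ R) (ℕ.≤-trans (s≤s (ℕ.m≤n+m c (length (map proj₂ kws)))) c≤W)) (
    step-rule (exec-write (keys≡ R) (keys‼ M₁) refl (‼-tabulate (int ∘ κ) w) refl) (
    step-rule (exec-pushFront (stack≡ R) (stack‼ M₂) refl) (
    execute (exec-first list≡ list‼₃) (
    weaken (λ {s} (P , t≡) → record
        { Pushed P
        ; registers = subst (λ c → Registers (regs s) c (length σ))
            (ℕ.+-suc (length (map proj₂ kws)) c) (Pushed.registers P)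
        ; frame     = λ v≢u → trans (Pushed.frame P v≢u) (frame₃ v≢u)
        }
      , trans (cong (7 ℕ.+_) t≡) (7+1+7*l (length (map proj₂ kws))))
    (pushLoop-correct kws
      record { Registers R ; counter≡ = refl }
      M₃ list≡ list‼₃ refl
      (subst (_≤ W) (sym (ℕ.+-suc (length (map proj₂ kws)) c)) c≤W)))))))))
    where
    M₁ = Memory-list M u {dll f′ (map cell kws)}
    h₁ = put (listAt u) (dll f′ (map cell kws)) h
    M₂ = Memory-key M₁ w (+ suc c)
    h₂ = put keysAt (array (put (toℕ w) (int (+ suc c)) (tabulate (int ∘ κ)))) h₁
    M₃ = Memory-stack M₂ {suc f} {(f , w) ∷ ks}
    h₃ = put stackAt (dll (suc f) (map cell ((f , w) ∷ ks))) h₂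
    list‼₃ : h₃ ‼ listAt u ≡ just (dll f′ (map cell kws))
    list‼₃ = trans (‼-put-≢ h₂ (listAt≢ 2)) (trans (‼-put-≢ h₁ (listAt≢ 0)) (‼-put (listAt u) h list‼))
    frame₃ : ∀ {v} → v ≢ u → h₃ ‼ listAt v ≡ h ‼ listAt v
    frame₃ v≢u = trans (‼-put-≢ h₂ (listAt≢ 2)) (trans (‼-put-≢ h₁ (listAt≢ 0))
                   (‼-put-≢ h (listAt-injective v≢u)))
    7+1+7*l : ∀ l → 7 + (1 + 7 * l) ≡ 1 + 7 * suc l
    7+1+7*l = solve-∀

  -- The main loop.

  Linked : Heap → (V → Val) → List V → Set
  Linked h links σ = ∀ v →
    (v ∉ σ × links v ≡ ref (listAt v) × h ‼ listAt v ≡ just (adjacencyList (neighbours v))) ⊎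
    -- The list of a numbered vertex is used up, so nothing is recorded of its contents.
    (v ∈ σ × links v ≡ nil)

  Linked-frame : ∀ {h h′ links σ} → (∀ v → h′ ‼ listAt v ≡ h ‼ listAt v) →
                 Linked h links σ → Linked h′ links σ
  Linked-frame same L v with L v
  ... | inj₁ (v∉σ , lv , list‼) = inj₁ (v∉σ , lv , trans (same v) list‼)
  ... | inj₂ closed             = inj₂ closed

  Linked-visit : ∀ {h h′ links σ u} → (∀ {v} → v ≢ u → h′ ‼ listAt v ≡ h ‼ listAt v) →
                 Linked h links σ → Linked h′ (updateAt links u (λ _ → nil)) (σ ∷ʳ u)
  Linked-visit {links = links} {σ} {u} same L v with v Fin.≟ u | L v
  ... | yes refl | _ = inj₂ (∈-++⁺ʳ σ (here refl) , updateAt-updates v links)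
  ... | no v≢u   | inj₁ (v∉σ , lv , list‼) = inj₁
        ( (λ v∈ → [ v∉σ , (λ { (here v≡u) → v≢u v≡u }) ]′ (∈-++⁻ σ v∈))
        , trans (updateAt-minimal v u links v≢u) lv
        , trans (same v≢u) list‼)
  ... | no v≢u   | inj₂ (v∈σ , lv) = inj₂ (∈-++⁺ˡ v∈σ , trans (updateAt-minimal v u links v≢u) lv)

  -- A visit takes at most 12 + d (7 + Λ) steps, 7 of which are charged to the pop; the other 7 d
  -- pay for popping the d neighbours that it pushes.
  visitCost : V → ℕ
  visitCost v = 5 + degree v * (14 + Λ)

  cost : List V → ℕ
  cost σ = sum (map visitCost σ)

  -- In `time`, 7 steps are allowed for each entry on the stack, one for the last test, and the cost
  -- of the vertices still to be numbered; `cost σ` stands on the left to avoid a subtraction.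
  record Searched (ks : ℕ) (σ : List V) (s : State) (t : ℕ) : Set where
    field
      {order}  : List V
      out≡     : regs s %out ≡ ref outAt
      out‼     : heap s ‼ outAt ≡ just (array (map vertex order))
      lexDFS   : IsLexDFSOrdering G order
      time     : t + cost σ ≤ 1 + 7 * ks + cost order

  -- Recursion on `N`, the number of pops to come: the entries now on the stack and the `D - c`
  -- future pushes.
  searchLoop-correct : ∀ N {ρ h links κ c σ f ks} →
    Registers ρ c (length σ) → Memory h links κ σ f ks →
    ρ %cursor ≡ toNode stackAt (List.head (map cell ks)) →
    Linked h links σ → Valid A κ c σ (map proj₂ ks) →
    N + c ≡ length ks + D →
    Terminates searchLoop ⟨ ρ , h ⟩ (Searched (length ks) σ)
  searchLoop-correct _ {σ = σ} {ks = []} R M cursor≡ _ v _ with Valid-empty A v | out‼ M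
  ... | full , lex | us , us≡ , len = stop-rule (test-nonNil-nil cursor≡) record
    { out≡   = out≡ R
    ; out‼   = trans us≡ (cong (λ us → just (array us)) (out-full us (trans len (sym full))))
    ; lexDFS = lex
    ; time   = ℕ.≤-refl
    }
    where
    out-full : ∀ us → length σ + length us ≡ length σ → map vertex σ ++ us ≡ map vertex σ
    out-full []       _ = List.++-identityʳ _
    out-full (_ ∷ us) e = ⊥-elim (ℕ.m+1+n≢m (length σ) e)
  searchLoop-correct zero {c = c} {ks = _ ∷ ks} _ _ _ _ v N+c≡ =
    -- With no pops left but a nonempty stack, the counter would exceed `D`.
    ⊥-elim (ℕ.<⇒≢ (ℕ.≤-<-trans (subst (_≤ D) (sym (Valid.count v)) (Valid.degrees≤ v))
                               (s≤s (ℕ.m≤n+m D (length ks)))) N+c≡)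
  searchLoop-correct (suc N) {ρ} {h} {links} {κ} {c} {σ} {f} {(k , u) ∷ ks} R M cursor≡ L v N+c≡
    with L u
  ... | inj₂ (u∈σ , closed) =
    loop-rule (test-nonNil-node cursor≡) (
    step-rule (exec-value cursor≡ (stack‼ M)) (
    step-rule (exec-remove cursor≡ (stack‼ M)) (
    step-rule (exec-read (adj≡ R) (links‼ M₁) refl (‼-tabulate links u)) (
    seq-rule (then-rule (test-isNil closed) (skip-rule (
    execute (exec-first (stack≡ R) (stack‼ M₁)) (
    weaken (λ {_} {t} P → record { Searched P ; time = bound t P })
    (searchLoop-correct N record { Registers R } M₁ refl
      (Linked-frame {h} {put stackAt (dll f (map cell ks)) h} (λ v → ‼-put-≢ h (listAt≢ 2)) L)
      (Valid-pop A u∈σ v)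
      (ℕ.suc-injective N+c≡))))))))))
    where
    open ℕ.≤-Reasoning
    M₁ = Memory-stack M {f} {ks}
    -- The 7 steps are the test, three instructions, the branch, its `skip` and the reloading of the
    -- cursor; the popped entry pays for them.
    bound : ∀ t {s} → (P : Searched (length ks) σ s t) →
            7 + t + cost σ ≤ 1 + 7 * suc (length ks) + cost (Searched.order P)
    bound t P = begin
      7 + (t + cost σ)                                         ≤⟨ ℕ.+-monoʳ-≤ 7 (Searched.time P) ⟩
      7 + (1 + 7 * length ks + cost (Searched.order P))        ≡⟨ rearrange (length ks) (cost (Searched.order P)) ⟩
      1 + 7 * suc (length ks) + cost (Searched.order P)        ∎
      where
      rearrange : ∀ l e → 7 + (1 + 7 * l + e) ≡ 1 + 7 * suc l + e
      rearrange = solve-∀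
  ... | inj₁ (u∉σ , open≡ , list‼)
    with kws , cells≡ , kws≡ ← adjacencyList-cells (neighbours u)
    with kws′ , sorted≡ , kws′↭ , kws′↗ ← sortKeyed-cells κ kws
    with v′ ← Valid-visit A u∉σ v (subst (map proj₂ kws′ ↭_) kws≡ kws′↭) kws′↗
    with Memory-link (Memory-stack M {f} {ks}) u
  ... | M₂ with out‼ M₂
  -- A full output array would contradict that `σ ∷ʳ u` has at most `n` entries.
  ... | [] , _ , len = ⊥-elim (ℕ.<⇒≢ (subst (_≤ n) (length-∷ʳ σ) (Valid.length≤n v′))
                                    (trans (sym (ℕ.+-identityʳ _)) len))
  ... | blank ∷ us , us≡ , len =
    loop-rule (test-nonNil-node cursor≡) (
    step-rule (exec-value cursor≡ (stack‼ M)) (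
    step-rule (exec-remove cursor≡ (stack‼ M)) (
    step-rule (exec-read (adj≡ R) (links‼ M₁) refl (‼-tabulate links u)) (
    seq-rule (else-rule (test-isNil-ref open≡) (
      step-rule (exec-write (adj≡ R) (links‼ M₁) refl (‼-tabulate links u) (nil≡ R)) (
      step-rule (exec-write (out≡ R) us≡ (pos≡ R) (‼-map-++ vertex σ) refl) (
      step-rule (exec-incr (pos≡ R) (ℕ.≤-trans (subst (_≤ n) (length-∷ʳ σ) (Valid.length≤n v′)) n≤W)) (
      step-rule (exec-sortBy open≡ list‼₃ (keys≡ R) (keys‼ M₃) (withKeys-cells κ kws)) (
      step-rule (exec-first open≡ list‼₄) (
      weaken (λ {s} (P , t≡) →
        execute (exec-first (stack≡ (Pushed.registers P)) (stack‼ (Pushed.memory P))) (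
        weaken (λ {_} {t} Q → record { Searched Q ; time = bound t≡ (Pushed.contents P) (Searched.time Q) })
        (searchLoop-correct N record { Registers (Pushed.registers P) } (Pushed.memory P) refl
          (Linked-visit {h} {heap s} {links} {σ} {u} (λ v≢u → trans (Pushed.frame P v≢u) (frame₄ v≢u)) L)
          (subst (Valid A _ _ _) (sym (Pushed.contents P)) v′)
          (fuel (Pushed.contents P)))))
      (pushLoop-correct kws′
        record { Registers R ; pos≡ = cong (λ p → int (+ p)) (sym (length-∷ʳ σ)) }
        (Memory-list M₃ u) open≡ list‼₄ refl
        -- After the pushes the counter is the degree sum of `σ ∷ʳ u`, hence within the word bound.
        (ℕ.≤-trans (subst (_≤ D) (sym (Valid.count v′)) (Valid.degrees≤ v′)) D≤W)))))))))))))
    where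
    open ℕ.≤-Reasoning
    M₁ = Memory-stack M {f} {ks}
    M₃ = Memory-out M₂ u us≡ len
    h₁ = put stackAt (dll f (map cell ks)) h
    h₂ = put 0 (array (put (toℕ u) nil (tabulate links))) h₁
    h₃ = put outAt (array (put (length σ) (vertex u) (map vertex σ ++ blank ∷ us))) h₂
    sorted = map proj₂ (sortKeyed (map (λ (k , w) → κ w , k , vertex w) kws))
    h₄ = put (listAt u) (dll (length (neighbours u)) sorted) h₃
    d  = length (map proj₂ kws′)

    d≡ : d ≡ degree u
    d≡ = trans (↭-length kws′↭) (cong length kws≡)

    frame₃ : ∀ {v} → h₃ ‼ listAt v ≡ h ‼ listAt v
    frame₃ = trans (‼-put-≢ h₂ (listAt≢ 1)) (trans (‼-put-≢ h₁ λ ()) (‼-put-≢ h (listAt≢ 2)))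

    list‼₃ : h₃ ‼ listAt u ≡ just (dll (length (neighbours u)) (map cell kws))
    list‼₃ = trans frame₃ (trans list‼ (cong just cells≡))

    list‼₄ : h₄ ‼ listAt u ≡ just (dll (length (neighbours u)) (map cell kws′))
    list‼₄ = trans (‼-put (listAt u) h₃ list‼₃) (cong (λ ns → just (dll (length (neighbours u)) ns)) sorted≡)

    frame₄ : ∀ {v} → v ≢ u → h₄ ‼ listAt v ≡ h ‼ listAt v
    frame₄ v≢u = trans (‼-put-≢ h₃ (listAt-injective v≢u)) frame₃

    length-cells : ∀ {ks′ : List (ℕ × V)} → map proj₂ ks′ ≡ map proj₂ kws′ ʳ++ map proj₂ ks →
                   length ks′ ≡ d + length ks
    length-cells {ks′} contents = begin-equality
      length ks′                                     ≡⟨ List.length-map proj₂ ks′ ⟨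
      length (map proj₂ ks′)                         ≡⟨ cong length contents ⟩
      length (map proj₂ kws′ ʳ++ map proj₂ ks)       ≡⟨ List.length-ʳ++ (map proj₂ kws′) ⟩
      d + length (map proj₂ ks)                      ≡⟨ cong (λ l → d + l) (List.length-map proj₂ ks) ⟩
      d + length ks                                  ∎

    -- One pop is spent, and the `d` pushes raise stack and counter alike.
    fuel : ∀ {ks′ : List (ℕ × V)} → map proj₂ ks′ ≡ map proj₂ kws′ ʳ++ map proj₂ ks →
           N + (d + c) ≡ length ks′ + D
    fuel {ks′} contents = begin-equality
      N + (d + c)             ≡⟨ exchange N d c ⟩
      d + (N + c)             ≡⟨ cong (λ l → d + l) (ℕ.suc-injective N+c≡) ⟩
      d + (length ks + D)     ≡⟨ ℕ.+-assoc d (length ks) D ⟨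
      d + length ks + D       ≡⟨ cong (λ l → l + D) (length-cells {ks′} contents) ⟨
      length ks′ + D          ∎
      where
      exchange : ∀ a b c → a + (b + c) ≡ b + (a + c)
      exchange = solve-∀

    sortTime : ℕ
    sortTime = length (map cell kws) * ⌈log₂ length (map cell kws) ⌉

    sortTime≤ : sortTime ≤ degree u * Λ
    sortTime≤ = begin
      sortTime                        ≡⟨ cong (λ l → l * ⌈log₂ l ⌉) (trans (List.length-map cell kws)
                                           (trans (sym (List.length-map proj₂ kws)) (cong length kws≡))) ⟩
      degree u * ⌈log₂ degree u ⌉     ≤⟨ ℕ.*-monoʳ-≤ (degree u) (⌈log₂⌉-mono-≤ degree≤D) ⟩
      degree u * Λ                    ∎
      where
      degree≤D : degree u ≤ D
      degree≤D = begin
        degree u                        ≤⟨ ℕ.m≤m+n (degree u) (degrees A σ) ⟩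
        degree u + degrees A σ          ≡⟨ sum-map-∷ʳ degree σ ⟨
        degrees A (σ ∷ʳ u)              ≤⟨ Valid.degrees≤ v′ ⟩
        D                               ∎

    bound : ∀ {t tₚ e} {ks′ : List (ℕ × V)} → tₚ ≡ 1 + 7 * d →
            map proj₂ ks′ ≡ map proj₂ kws′ ʳ++ map proj₂ ks →
            t + cost (σ ∷ʳ u) ≤ 1 + 7 * length ks′ + e →
            1 + (3 + ((4 + ((1 + sortTime) + (1 + tₚ))) + 1)) + t + cost σ ≤ 1 + 7 * suc (length ks) + e
    -- Adding `7 * d` to both sides expresses that the visit prepays the pops of the `d` entries it
    -- pushes.
    bound {t} {tₚ} {e} {ks′} refl contents t≤ = ℕ.+-cancelʳ-≤ (7 * d) _ _ (begin
      1 + (3 + ((4 + ((1 + sortTime) + (1 + tₚ))) + 1)) + t + cost σ + 7 * d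
        ≡⟨ gather sortTime d t (cost σ) ⟩
      7 + (t + (5 + (d * 14 + sortTime) + cost σ))
        ≤⟨ ℕ.+-monoʳ-≤ 7 (ℕ.+-monoʳ-≤ t (ℕ.+-monoˡ-≤ (cost σ)
             (ℕ.+-monoʳ-≤ 5 (ℕ.+-monoʳ-≤ (d * 14) sortTime≤)))) ⟩
      7 + (t + (5 + (d * 14 + degree u * Λ) + cost σ))
        ≡⟨ cong (λ l → 7 + (t + (5 + (l * 14 + degree u * Λ) + cost σ))) d≡ ⟩
      7 + (t + (5 + (degree u * 14 + degree u * Λ) + cost σ))
        ≡⟨ cong (λ l → 7 + (t + (5 + l + cost σ))) (ℕ.*-distribˡ-+ (degree u) 14 Λ) ⟨
      7 + (t + (visitCost u + cost σ))
        ≡⟨ cong (λ l → 7 + (t + l)) (sum-map-∷ʳ visitCost σ) ⟨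
      7 + (t + cost (σ ∷ʳ u))
        ≤⟨ ℕ.+-monoʳ-≤ 7 t≤ ⟩
      7 + (1 + 7 * length ks′ + e)
        ≡⟨ cong (λ l → 7 + (1 + 7 * l + e)) (length-cells {ks′} contents) ⟩
      7 + (1 + 7 * (d + length ks) + e)
        ≡⟨ spread d (length ks) e ⟩
      1 + 7 * suc (length ks) + e + 7 * d ∎)
      where
      gather : ∀ x d t e → 1 + (3 + ((4 + ((1 + x) + (1 + (1 + 7 * d)))) + 1)) + t + e + 7 * d ≡
                           7 + (t + (5 + (d * 14 + x) + e))
      gather = solve-∀
      spread : ∀ d l e → 7 + (1 + 7 * (d + l) + e) ≡ 1 + 7 * suc l + e + 7 * d
      spread = solve-∀

  -- Initialisation and the whole program.

  record Filled (h : Heap) (links : V → Val) (κ : V → ℤ) (s : State) : Set where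
    field
      {fresh}   : ℕ
      {cells}   : List (ℕ × V)
      registers : Registers (regs s) 0 n
      memory    : Memory (heap s) links κ [] fresh cells
      size      : length cells ≡ n
      full      : ∀ w → w ∈ map proj₂ cells
      frame     : ∀ v → heap s ‼ listAt v ≡ h ‼ listAt v

  -- `k` rounds remain, each costing a test and two instructions. Vertices are represented by
  -- integers, so the loop counter `%pos` is itself the vertex to push.
  fillLoop-correct : ∀ k {ρ h links κ f ks j} → k + j ≡ n →
    Registers ρ 0 j → Memory h links κ [] f ks →
    length ks ≡ j → (∀ w → toℕ w < j → w ∈ map proj₂ ks) →
    Terminates fillLoop ⟨ ρ , h ⟩ λ s t → Filled h links κ s × t ≡ 1 + 3 * k
  fillLoop-correct zero refl R M size full =
    stop-rule (subst (Tests _ _) (dec-false (+ n ℤ.<? + n) (ℤ.<-irrefl refl)) (test-less (pos≡ R) (n≡ R)))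
      ( record { registers = R ; memory = M ; size = size
               ; full = λ w → full w (Fin.toℕ<n w) ; frame = λ _ → refl }
      , refl)
  fillLoop-correct (suc k) {ρ} {h} {links} {κ} {f} {ks} {j} k+j≡n R M size full =
    loop-rule (subst (Tests _ _) (dec-true (_ ℤ.<? _) (ℤ.+<+ j<n)) (test-less (pos≡ R) (n≡ R))) (
    step-rule (exec-pushFront (stack≡ R) (stack‼ M) (trans (pos≡ R) (cong (λ i → int (+ i)) (sym toℕw≡j)))) (
    execute (exec-incr (pos≡ R) (ℕ.≤-trans j<n n≤W)) (
    weaken (λ (F , t≡) → record
        { Filled F ; frame = λ v → trans (Filled.frame F v) (‼-put-≢ h (listAt≢ 2)) }
      , trans (cong (3 ℕ.+_) t≡) (3+1+3*k k))
    (fillLoop-correct k (trans (ℕ.+-suc k j) k+j≡n) record { Registers R ; pos≡ = refl }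
      (Memory-stack M {suc f} {(f , w) ∷ ks}) (cong suc size) full′))))
    where
    j<n : j < n
    j<n = subst (suc j ≤_) k+j≡n (s≤s (ℕ.m≤n+m j k))
    w : V
    w = fromℕ< j<n
    toℕw≡j : toℕ w ≡ j
    toℕw≡j = Fin.toℕ-fromℕ< j<n
    full′ : ∀ v → toℕ v < suc j → v ∈ map proj₂ ((f , w) ∷ ks)
    full′ v (s≤s v≤j) with ℕ.m≤n⇒m<n∨m≡n v≤j
    ... | inj₁ v<j = there (full v v<j)
    ... | inj₂ v≡j = here (Fin.toℕ-injective (trans v≡j (sym toℕw≡j)))
    3+1+3*k : ∀ k → 3 + (1 + 3 * k) ≡ 1 + 3 * suc k
    3+1+3*k = solve-∀

  -- The source alone starts with a key above all others, as its initial label is ∞;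
  -- starting at -1 keeps the counter within 2m.
  initialKey : V → ℤ
  initialKey = updateAt (λ _ → -[1+ 0 ]) source (λ _ → + 0)

  initialKey-source : initialKey source ≡ + 0
  initialKey-source = updateAt-updates source _

  initialKey-other : ∀ {v} → v ≢ source → initialKey v ≡ -[1+ 0 ]
  initialKey-other {v} = updateAt-minimal v source _

  initialKey≤0 : ∀ v → initialKey v ℤ.≤ + 0
  initialKey≤0 v with v Fin.≟ source
  ... | yes refl = ℤ.≤-reflexive initialKey-source
  ... | no  v≢s  = subst (ℤ._≤ + 0) (sym (initialKey-other v≢s)) -≤+

  -1≤initialKey : ∀ v → -[1+ 0 ] ℤ.≤ initialKey v
  -1≤initialKey v with v Fin.≟ source
  ... | yes refl = subst (_ ℤ.≤_) (sym initialKey-source) -≤+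
  ... | no  v≢s  = ℤ.≤-reflexive (sym (initialKey-other v≢s))

  initialKey-max : ∀ v → initialKey source ℤ.≤ initialKey v → v ≡ source
  initialKey-max v s≤v = decidable-stable (v Fin.≟ source) λ v≢s →
    0≰-1 (subst₂ ℤ._≤_ initialKey-source (initialKey-other v≢s) s≤v)
    where
    0≰-1 : ¬ (+ 0 ℤ.≤ -[1+ 0 ])
    0≰-1 ()

  -- The source is on top, and every other vertex has the least key, so that any occurrence of it
  -- will do.
  Reach-initial : ∀ {S} → (∀ w → w ∈ S) → ∀ w → Reach G initialKey w (source ∷ S)
  Reach-initial full w with w Fin.≟ source
  ... | yes refl = here
  ... | no  w≢s  = there (κw-min source) (∈⇒Reach G κw-min (full w))
    where
    κw-min : ∀ x → initialKey w ℤ.≤ initialKey x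
    κw-min x = subst (ℤ._≤ _) (sym (initialKey-other w≢s)) (-1≤initialKey x)

  length-heap : length (heap (input A)) ≡ suc n
  length-heap = cong suc (List.length-tabulate _)

  n>0 : 0 < n
  n>0 = ℕ.≤-<-trans z≤n (Fin.toℕ<n source)

  program-correct : Terminates program (input A) λ s t →
    ∃[ σ ] Outputs s σ × IsLexDFSOrdering G σ × t ≤ 21 + 12 * n + cost σ
  program-correct =
    step-rule exec-setNil (
    step-rule (exec-const (ℕ.≤-trans n>0 n≤W)) (
    step-rule (exec-newArray refl refl length-heap) (
    step-rule (exec-newArray refl refl length₁) (
    step-rule (exec-newList length₂) (
    step-rule (exec-const z≤n) (
    step-rule (exec-write refl (keys‼ M₃) refl (‼-tabulate (λ _ → int -[1+ 0 ]) source) refl) (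
    step-rule (exec-const z≤n) (
    seq-rule (weaken (λ {s} (F , t≡) →
      step-rule (exec-pushFront (stack≡ (Filled.registers F)) (stack‼ (Filled.memory F))
                                (source≡ (Filled.registers F))) (
      step-rule (exec-const z≤n) (
      step-rule (exec-first (stack≡ (Filled.registers F)) (stack‼ (pushSource F))) (
      seq-rule (weaken (λ {_} {t} Q → execute exec-copy
          ( Searched.order Q , (outAt , Searched.out≡ Q , Searched.out‼ Q) , Searched.lexDFS Q
          , bound t≡ (Filled.size F) (Searched.time Q)))
        -- The counter is 0, so the pops ahead are those of the `n + 1` initial entries and of `D`
        -- pushes.
        (searchLoop-correct (suc (length (Filled.cells F)) + D)
          record { Registers (Filled.registers F) ; pos≡ = refl }
          (pushSource F) refl
          (λ v → inj₁ ((λ ()) , refl , trans (‼-put-≢ (heap s) (listAt≢ 2)) (trans (Filled.frame F v) (lists v))))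
          (Valid-initial A initialKey≤0 initialKey-max (Reach-initial (Filled.full F)))
          (ℕ.+-identityʳ _)))))))
    (fillLoop-correct n (ℕ.+-identityʳ n)
      record { adj≡ = refl ; n≡ = refl ; source≡ = refl ; counter≡ = refl ; keys≡ = refl
             ; out≡ = refl ; stack≡ = refl ; pos≡ = refl ; nil≡ = refl }
      (Memory-key M₃ source (+ 0)) refl (λ _ ())))))))))))
    where
    h₀ = heap (input A)
    h₁ = h₀ ∷ʳ array (replicate n (int -[1+ 0 ]))
    h₂ = h₁ ∷ʳ array (replicate n nil)
    h₃ = h₂ ∷ʳ dll 0 []

    length₁ : length h₁ ≡ outAt
    length₁ = trans (length-∷ʳ h₀) (cong suc length-heap)

    length₂ : length h₂ ≡ stackAt
    length₂ = trans (length-∷ʳ h₁) (cong suc length₁)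

    old : ∀ ℓ {o} → h₀ ‼ ℓ ≡ just o → h₃ ‼ ℓ ≡ just o
    old ℓ = ‼-∷ʳ-old ℓ h₂ ∘ ‼-∷ʳ-old ℓ h₁ ∘ ‼-∷ʳ-old ℓ h₀

    M₃ : Memory h₃ (ref ∘ listAt) (λ _ → -[1+ 0 ]) [] 0 []
    M₃ = record
      { links‼ = old 0 refl
      ; keys‼  = ‼-∷ʳ-old keysAt h₂ (‼-∷ʳ-old keysAt h₁
                   (trans (‼-∷ʳ-new h₀ length-heap) (cong (λ us → just (array us)) (replicate≡tabulate n _))))
      ; out‼   = replicate n nil , ‼-∷ʳ-old outAt h₂ (‼-∷ʳ-new h₁ length₁) , List.length-replicate n
      ; stack‼ = ‼-∷ʳ-new h₂ length₂
      }

    h₄ = put keysAt (array (put (toℕ source) (int (+ 0)) (tabulate (λ _ → int -[1+ 0 ])))) h₃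

    pushSource : ∀ {s} (F : Filled h₄ (ref ∘ listAt) initialKey s) →
      let open Filled F in
      Memory (put stackAt (dll (suc fresh) (map cell ((fresh , source) ∷ cells))) (heap s))
             (ref ∘ listAt) initialKey [] (suc fresh) ((fresh , source) ∷ cells)
    pushSource F = Memory-stack (Filled.memory F)

    lists : ∀ v → h₄ ‼ listAt v ≡ just (adjacencyList (neighbours v))
    lists v = trans (‼-put-≢ h₃ (listAt≢ 0)) (old (listAt v) (‼-tabulate (adjacencyList ∘ neighbours) v))

    bound : ∀ {tᶠ t l e} → tᶠ ≡ 1 + 3 * n → l ≡ n → t + 0 ≤ 1 + 7 * suc l + e →
            1 + (1 + ((1 + n) + ((1 + n) + (1 + (1 + (1 + (1 + (tᶠ + (1 + (1 + (1 + (t + 1))))))))))))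
            ≤ 21 + 12 * n + e
    bound {t = t} {e = e} refl refl t≤ = begin
      1 + (1 + ((1 + n) + ((1 + n) + (1 + (1 + (1 + (1 + ((1 + 3 * n) + (1 + (1 + (1 + (t + 1))))))))))))
                                                ≡⟨ gather n t ⟩
      13 + 5 * n + (t + 0)                      ≤⟨ ℕ.+-monoʳ-≤ (13 + 5 * n) t≤ ⟩
      13 + 5 * n + (1 + 7 * suc n + e)          ≡⟨ spread n e ⟩
      21 + 12 * n + e                           ∎
      where
      open ℕ.≤-Reasoning
      gather : ∀ n t →
               1 + (1 + ((1 + n) + ((1 + n) + (1 + (1 + (1 + (1 + ((1 + 3 * n) + (1 + (1 + (1 + (t + 1))))))))))))
               ≡ 13 + 5 * n + (t + 0)
      gather = solve-∀
      spread : ∀ n e → 13 + 5 * n + (1 + 7 * suc n + e) ≡ 21 + 12 * n + e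
      spread = solve-∀

  -- The final time bound.

  cost≤ : ∀ {σ} → IsLexDFSOrdering G σ → cost σ ≤ 5 * n + 2 * m * (16 + ⌊log₂ m ⌋)
  cost≤ {σ} (_ , search) = begin
    cost σ                                     ≤⟨ sum-mono-⊆ visitCost (search-unique A search)
                                                                      (λ _ → ∈-allFin _) ⟩
    cost (allFin n)                            ≡⟨ sum-map-affine degree 5 (14 + Λ) (allFin n) ⟩
    5 * length (allFin n) + D * (14 + Λ)       ≡⟨ cong (λ l → 5 * l + D * (14 + Λ))
                                                        (List.length-tabulate {n = n} id) ⟩
    -- `Λ` exceeds `⌊log₂ m⌋` by at most 2, which turns 14 into 16.
    5 * n + D * (14 + Λ)                       ≤⟨ ℕ.+-monoʳ-≤ (5 * n)
                                                    (ℕ.*-mono-≤ sum-degree≤2m (ℕ.+-monoʳ-≤ 14 Λ≤)) ⟩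
    5 * n + 2 * m * (16 + ⌊log₂ m ⌋)           ∎
    where
    open ℕ.≤-Reasoning
    Λ≤ : Λ ≤ 2 + ⌊log₂ m ⌋
    Λ≤ = ℕ.≤-trans (⌈log₂⌉-mono-≤ sum-degree≤2m) (⌈log₂[2*n]⌉≤2+⌊log₂n⌋ m)

  -- This absorbs the term linear in `m`. From `m = 2` on the logarithm is at least 1; for `m = 1`
  -- it vanishes and the source gives `n ≥ 1`.
  m≤n+m*⌊log₂m⌋ : m ≤ n + m * ⌊log₂ m ⌋
  m≤n+m*⌊log₂m⌋ = m≤ m
    where
    open ℕ.≤-Reasoning
    m≤ : ∀ m → m ≤ n + m * ⌊log₂ m ⌋
    m≤ zero              = z≤n
    m≤ (suc zero)        = ℕ.≤-trans n>0 (ℕ.m≤m+n n _)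
    m≤ m@(suc (suc m-2)) = begin
      m                    ≡⟨ ℕ.*-identityʳ m ⟨
      m * 1                ≤⟨ ℕ.*-monoʳ-≤ m (⌊log₂⌋-mono-≤ {2} {m} (s≤s (s≤s z≤n))) ⟩
      m * ⌊log₂ m ⌋        ≤⟨ ℕ.m≤n+m _ n ⟩
      n + m * ⌊log₂ m ⌋    ∎

  time≤ : ∀ {σ t} → IsLexDFSOrdering G σ → t ≤ 21 + 12 * n + cost σ → t ≤ 70 * (n + m * ⌊log₂ m ⌋)
  time≤ {σ} {t} lex t≤ = begin
    t                                                        ≤⟨ t≤ ⟩
    21 + 12 * n + cost σ                                     ≤⟨ ℕ.+-monoʳ-≤ (21 + 12 * n) (cost≤ lex) ⟩
    21 + 12 * n + (5 * n + 2 * m * (16 + ⌊log₂ m ⌋))         ≡⟨ gather n m ⌊log₂ m ⌋ ⟩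
    21 * 1 + 17 * n + 32 * m + 2 * (m * ⌊log₂ m ⌋)
      -- The constant 21 becomes `21 * n`, and the coefficient 2 is enlarged to 38 so that both
      -- totals are 70 = 21 + 17 + 32 = 32 + 38.
      ≤⟨ ℕ.+-mono-≤ (ℕ.+-mono-≤ (ℕ.+-monoˡ-≤ (17 * n) (ℕ.*-monoʳ-≤ 21 n>0)) (ℕ.*-monoʳ-≤ 32 m≤n+m*⌊log₂m⌋))
                    (ℕ.*-monoˡ-≤ (m * ⌊log₂ m ⌋) {2} {38} (ℕ.m≤m+n 2 36)) ⟩
    21 * n + 17 * n + 32 * (n + m * ⌊log₂ m ⌋) + 38 * (m * ⌊log₂ m ⌋)  ≡⟨ spread n (m * ⌊log₂ m ⌋) ⟩
    70 * (n + m * ⌊log₂ m ⌋)                                 ∎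
    where
    open ℕ.≤-Reasoning
    gather : ∀ n m l → 21 + 12 * n + (5 * n + 2 * m * (16 + l)) ≡ 21 * 1 + 17 * n + 32 * m + 2 * (m * l)
    gather = solve-∀
    spread : ∀ n k → 21 * n + 17 * n + 32 * (n + k) + 38 * k ≡ 70 * (n + k)
    spread = solve-∀

theorem4p1 : ∃[ P ] ∃[ c ]
    ((G : Graph) → Graph.Connected G → (A : AdjacencyLists G) →
    ∃[ s ] ∃[ t ] ∃[ σ ]
    (wordBound G ⊢ P , input A ⇓ s ∣ t) ×
    Outputs s σ ×
    IsLexDFSOrdering G σ ×
    t ≤ c * (Graph.n G + Graph.m G * ⌊log₂ Graph.m G ⌋))
theorem4p1 = program , 70 , λ G _ A →
  let open Correctness A
      open Execution.Terminates program-correct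
      σ , outputs , lex , t≤ = post
  in final , time , σ , run , outputs , lex , time≤ lex t≤
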